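{- For every $n\ge 11$ with $n\equiv 3\pmod 4$ there exists an integer $9$-diagonal globally simple $\mathrm{H}_9(n;9)$ with width $\frac{n-9}{2}$.
   Context: A partially filled (p.f.) array is a matrix in which some cells may be empty. Let $n\ge k\ge 3$, let $t$ divide $2nk$, put $v=2nk+t$ and let $J$ be the subgroup of $\mathbb{Z}_v$ of order $t$. An $\mathrm{H}_t(n;k)$ (square relative Heffter array) is an $n\times n$ p.f. array with elements in $\mathbb{Z}_v$ such that each row and each column has exactly $k$ filled cells; for every $x\in\mathbb{Z}_v\setminus J$ either $x$ or $-x$ appears in the array; and the elements of every row and column sum to $0$. It is integer if moreover the elements of every row and column, viewed as integers in $\pm\{1,\dots,\lfloor\frac{2nk+t}{2}\rfloor\}$, sum to $0$ in $\mathbb{Z}$. The natural ordering of a row (column) is the ordering of its filled cells from left to right (top to bottom). An ordering $(t_1,\dots,t_\ell)$ of elements of an abelian group is simple if its partial sums $s_i=t_1+\dots+t_i$, $1\le i\le\ell$, are pairwise distinct. The array is globally simple if the natural ordering of each row and each column is simple (partial sums computed in $\mathbb{Z}_v$). For an $n\times n$ array and $i\in\{1,\dots,n\}$, the $i$-th diagonal is $D_i=\{(i,1),(i+1,2),\dots,(i-1,n)\}$, indices taken modulo $n$ in $\{1,\dots,n\}$. A p.f. array of size $n\ge k$ is $k$-diagonal if its nonempty cells are exactly those of $k$ diagonals. For a $k$-diagonal array with $n>k$, a set $\{D_{r+1},\dots,D_{r+\ell}\}$ (indices mod $n$) is an empty strip of width $\ell$ if $D_{r+1},\dots,D_{r+\ell}$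 are empty diagonals while $D_r$ and $D_{r+\ell+1}$ are filled diagonals. The array is $k$-diagonal with width $\ell$ if all its empty strips have width $\ell$. -}

module Defs where

open import Data.Nat.Base as ℕ using (ℕ; NonZero; suc; _≤_; _<_; _∸_; >-nonZero; >-nonZero⁻¹)
import Data.Nat.Properties as ℕ
open import Data.Nat.DivMod using (_/_; _mod_)
open import Data.Nat.Divisibility using (_∣_)
open import Data.Integer.Base as ℤ using (ℤ; +_; 0ℤ)
open import Data.Fin.Base using (Fin; toℕ)
open import Data.Fin.Properties using (nonZeroIndex)
open import Data.Fin.Subset using (Subset; _∈_; _∉_; ∣_∣)
open import Data.List.Base using (List; allFin; foldr; length; map; mapMaybe; take)
open import Data.Maybe using (Maybe; just; Is-just; Is-nothing)
open import Data.Product.Base using (∃; ∃₂; _×_)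
open import Data.Sum.Base using (_⊎_)
open import Function.Bundles using (_⇔_)
open import Function.Definitions using (Injective)
open import Relation.Binary.PropositionalEquality.Core using (_≡_)
open import Relation.Nullary.Decidable.Core using (yes; no)
open import Relation.Nullary.Negation.Core using (¬_)

-- The residue class of a modulo m is represented by the element of Fin m
-- with value a mod m.  This serves both for ℤ_v and for indices modulo n.

infixl 6 _⊕_ _⊕ℕ_
infix  8 ⊖_

_⊕ℕ_ : ∀ {m} → Fin m → ℕ → Fin m
_⊕ℕ_ {m} x a = _mod_ (toℕ x ℕ.+ a) m {{nonZeroIndex x}}

_⊕_ : ∀ {m} → Fin m → Fin m → Fin m
x ⊕ y = x ⊕ℕ toℕ y

⊖_ : ∀ {m} → Fin m → Fin m
⊖_ {m} x = _mod_ (m ∸ toℕ x) m {{nonZeroIndex x}}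

𝟘 : ∀ {m} .{{_ : NonZero m}} → Fin m
𝟘 {m} = 0 mod m

∑ : ∀ {m} .{{_ : NonZero m}} → List (Fin m) → Fin m
∑ = foldr _⊕_ 𝟘

∑ℤ : List ℤ → ℤ
∑ℤ = foldr ℤ._+_ 0ℤ

-- The representative of least absolute value.  Nonzero classes are sent into
-- ±{1, …, ⌊m/2⌋}; for even m the class of m/2 is sent to + m/2.
toℤ : ∀ {m} → Fin m → ℤ
toℤ {m} x with toℕ x ℕ.≤? m / 2
... | yes _ = + toℕ x
... | no  _ = + toℕ x ℤ.- + m

record IsSubgroup {m} .{{_ : NonZero m}} (J : Subset m) : Set where
  field
    𝟘∈       : 𝟘 ∈ J
    ⊕-closed : ∀ {x y} → x ∈ J → y ∈ J → x ⊕ y ∈ J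
    ⊖-closed : ∀ {x} → x ∈ J → ⊖ x ∈ J

-- Index i is 0-based, so this is s₍ᵢ₊₁₎ = t₁ + ⋯ + t₍ᵢ₊₁₎.
partialSum : ∀ {m} .{{_ : NonZero m}} (ts : List (Fin m)) → Fin (length ts) → Fin m
partialSum ts i = ∑ (take (suc (toℕ i)) ts)

Simple : ∀ {m} .{{_ : NonZero m}} → List (Fin m) → Set
Simple ts = Injective _≡_ _≡_ (partialSum ts)

-- Square partially filled arrays: A r c is the cell in row r and column c
-- (both counted from 0), with nothing for an empty cell.
PFArray : ℕ → Set → Set
PFArray n X = Fin n → Fin n → Maybe X

module _ {n : ℕ} {X : Set} (A : PFArray n X) where

  row : Fin n → List X
  row r = mapMaybe (λ c → A r c) (allFin n)

  column : Fin n → List X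
  column c = mapMaybe (λ r → A r c) (allFin n)

  Appears : X → Set
  Appears x = ∃₂ λ r c → A r c ≡ just x

-- Diagonals are indexed from 0: D d = {(d , 0), (d + 1 , 1), …, (d - 1 , n - 1)}.
OnDiagonal : ∀ {n} → Fin n → Fin n → Fin n → Set
OnDiagonal d r c = r ≡ d ⊕ c

module _ {n : ℕ} {X : Set} (A : PFArray n X) where

  FilledDiagonal : Fin n → Set
  FilledDiagonal d = ∀ r c → OnDiagonal d r c → Is-just (A r c)

  EmptyDiagonal : Fin n → Set
  EmptyDiagonal d = ∀ r c → OnDiagonal d r c → Is-nothing (A r c)

  IsDiagonal : ℕ → Set
  IsDiagonal k = ∃ λ (d : Fin k → Fin n) → Injective _≡_ _≡_ d ×
    (∀ r c → Is-just (A r c) ⇔ (∃ λ i → OnDiagonal (d i) r c))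

  -- The strip D (r + 1), …, D (r + ℓ); it is required to be nonempty, so two
  -- adjacent filled diagonals do not bound a strip of width 0.
  record IsEmptyStrip (r : Fin n) (ℓ : ℕ) : Set where
    field
      nonempty     : 1 ≤ ℓ
      filledBefore : FilledDiagonal r
      empty        : ∀ i → 1 ≤ i → i ≤ ℓ → EmptyDiagonal (r ⊕ℕ i)
      filledAfter  : FilledDiagonal (r ⊕ℕ suc ℓ)

  record IsDiagonalWithWidth (k ℓ : ℕ) : Set where
    field
      k<n      : k < n
      diagonal : IsDiagonal k
      width    : ∀ r w → IsEmptyStrip r w → w ≡ ℓ

modulus : ℕ → ℕ → ℕ → ℕ
modulus n k t = 2 ℕ.* n ℕ.* k ℕ.+ t

module Heffter (n k t : ℕ) .{{_ : NonZero t}} where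

  v : ℕ
  v = modulus n k t

  instance
    v-nonZero : NonZero v
    v-nonZero = >-nonZero (ℕ.<-≤-trans (>-nonZero⁻¹ t) (ℕ.m≤n+m t (2 ℕ.* n ℕ.* k)))

  Array : Set
  Array = PFArray n (Fin v)

  record IsHeffter (A : Array) : Set where
    field
      3≤k         : 3 ≤ k
      k≤n         : k ≤ n
      t∣2nk       : t ∣ 2 ℕ.* n ℕ.* k
      rowSize     : ∀ r → length (row A r) ≡ k
      columnSize  : ∀ c → length (column A c) ≡ k
      -- ℤ_v is cyclic, so J is determined by its order.
      J           : Subset v
      J-subgroup  : IsSubgroup J
      J-order     : ∣ J ∣ ≡ t
      -- The alternative is exclusive; nk filled cells against 2nk elements
      -- outside J would force this even if it were not demanded.
      support     : ∀ x → x ∉ J →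
                    (Appears A x × ¬ Appears A (⊖ x)) ⊎
                    (¬ Appears A x × Appears A (⊖ x))
      rowSum      : ∀ r → ∑ (row A r) ≡ 𝟘
      columnSum   : ∀ c → ∑ (column A c) ≡ 𝟘

  record IsInteger (A : Array) : Set where
    field
      rowSumℤ    : ∀ r → ∑ℤ (map toℤ (row A r)) ≡ 0ℤ
      columnSumℤ : ∀ c → ∑ℤ (map toℤ (column A c)) ≡ 0ℤ

  record IsGloballySimple (A : Array) : Set where
    field
      rowSimple    : ∀ r → Simple (row A r)
      columnSimple : ∀ c → Simple (column A c)

{-# OPTIONS --safe #-}
module Submission where

-- Write n = 11 + 4p, N = 2n + 1 and h = (n + 1) / 2, so that v = 9N, J = ⟨N⟩ and
-- 2h ≡ 1 (mod n).  For any d : ℤ_n → ℤ, the three diagonals o, o + h, o + 1 with entries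
--   d(c - h) + A - κ,   κ - d(c) - d(c - h),   d(c)
-- in column c have all row and column sums equal to A.  The nine filled diagonals
-- 0, …, 4, h, …, h + 3 are three such triples, o = 0, 3, h + 1, with A = a, -a, 0.
-- In the first two, d is an arithmetic progression, and each diagonal carries n consecutive
-- integers of one sign.  In the third, d = 4N + s and κ = 8N, where both |s(c)| and
-- |s(c) + s(c - h)| run over 1, …, n; it carries 1, …, n and 4N ± 1, …, 4N ± n.
-- No triple is contiguous in the cyclic order of the diagonals.  All entries are piecewise
-- affine in p and in the position, and so are the partial sums of rows and columns; between
-- consecutive breakpoints the difference of any two of them stays, for all p, strictly
-- between two consecutive multiples of v.

-- The row sums work because row r meets the diagonals o, o + h, o + 1 in the columns r - o, r - o -
-- h, r - o - 1, and 2h ≡ 1 lets d(r - o - 2h) cancel d(r - o - 1).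
--
-- The sums a and -a are forced by the progressions. Up to sign such a diagonal fills a block kN +
-- 1, ..., kN + n or kN + n + 1, ..., kN + 2n. Twice the mean of a block is n + 1 + 2jn + 2kN with j
-- = 0 or 1, and no signed sum of three such means vanishes: it would make an odd multiple of n
-- equal to an odd number that is too small or has the wrong sign. So the two progressions are
-- paired with opposite sums, |a| = (3n + 1)/2, and the triple with sum 0 needs a different d.
--
-- In that triple the diagonals carry s(c - h) - 4N, -(s(c) + s(c - h)) and 4N + s(c). Whatever the
-- signs of s, the outer two exhaust 4N ± 1, ..., 4N ± n up to sign, so s may bend freely to make
-- s(c) + s(c - h) run through 1, ..., n in absolute value.
--
-- Since this triple sums to 0, placing its diagonals side by side would make two partial sums
-- coincide; hence the interleaving.

open import Defs
open import Data.Nat.Base using (ℕ; _≥_; _∸_)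
open import Data.Nat.DivMod using (_/_; _%_)
open import Data.Product.Base using (∃; _×_)
open import Relation.Binary.PropositionalEquality.Core using (_≡_)

-- Finite maps on ℕ, and the order in which a cyclic scan meets their keys

module AssociationLists where

  open import Data.Nat.Base as ℕ using (ℕ; zero; suc; NonZero; _+_; _*_; _∸_; _≤_; _<_)
  import Data.Nat.Properties as ℕ
  open import Data.Nat.DivMod using (_/_; _%_; m≡m%n+[m/n]*n; m<n⇒m%n≡m; m≤n⇒[n∸m]%m≡n%m)
  open import Data.Fin.Base using (Fin; zero; suc; toℕ)
  open import Data.List.Base using (List; []; _∷_; map; _++_; reverse; [_]; tabulate; catMaybes)
  import Data.List.Properties as List
  open import Data.List.Relation.Unary.All as All using (All; []; _∷_)
  import Data.List.Relation.Unary.All.Properties as All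
  open import Data.List.Relation.Unary.Any using (Any; here; there)
  open import Data.List.Relation.Unary.AllPairs as AllPairs using (AllPairs; []; _∷_)
  import Data.List.Relation.Unary.AllPairs.Properties as AllPairs
  open import Data.List.Relation.Binary.Permutation.Propositional using (↭-sym)
  open import Data.List.Relation.Binary.Permutation.Propositional.Properties using (All-resp-↭; ↭-reverse)
  open import Data.Maybe.Base using (Maybe; just; nothing; _<∣>_)
  open import Data.Product.Base using (_×_; _,_; proj₁; proj₂; ∃₂; map₁)
  open import Data.Sum.Base using (_⊎_; inj₁; inj₂)
  open import Function.Base using (_on_; _∘_)
  open import Relation.Binary.PropositionalEquality hiding ([_])
  open import Relation.Nullary using (¬_; yes; no; contradiction)

  -- Equal remainders would force a larger quotient for `t`, hence `s + n ≤ t`. Keys inside one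
  -- window of length n therefore stay distinct modulo n.
  window⇒%≢ : ∀ {s t n} .{{_ : NonZero n}} → s < t → t < s + n → s % n ≢ t % n
  window⇒%≢ {s} {t} {n} s<t t<s+n s%n≡t%n = ℕ.<⇒≱ t<s+n (begin
    s + n                           ≡⟨ cong (_+ n) (m≡m%n+[m/n]*n s n) ⟩
    s % n + s / n * n + n           ≡⟨ ℕ.+-assoc (s % n) (s / n * n) n ⟩
    s % n + (s / n * n + n)         ≡⟨ cong₂ _+_ s%n≡t%n (ℕ.+-comm (s / n * n) n) ⟩
    t % n + suc (s / n) * n         ≤⟨ ℕ.+-monoʳ-≤ (t % n) (ℕ.*-monoˡ-≤ n s/n<t/n) ⟩
    t % n + t / n * n               ≡⟨ m≡m%n+[m/n]*n t n ⟨
    t                               ∎)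
    where
    open ℕ.≤-Reasoning
    s/n<t/n : s / n < t / n
    s/n<t/n = ℕ.*-cancelʳ-< n (s / n) (t / n) (ℕ.+-cancelˡ-< (t % n) (s / n * n) (t / n * n)
      (subst₂ _<_ (trans (m≡m%n+[m/n]*n s n) (cong (_+ s / n * n) s%n≡t%n)) (m≡m%n+[m/n]*n t n) s<t))

  reverse⁺ : ∀ {A : Set} {P : A → Set} {xs} → All P xs → All P (reverse xs)
  reverse⁺ {xs = xs} = All-resp-↭ (↭-sym (↭-reverse xs))

  reverse-allPairs⁺ : ∀ {A : Set} {R : A → A → Set} {xs} → AllPairs R xs → AllPairs (λ x y → R y x) (reverse xs)
  reverse-allPairs⁺ []                         = []
  reverse-allPairs⁺ {R = R} {x ∷ xs} (Rx ∷ Rxs) =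
    subst (AllPairs _) (sym (List.unfold-reverse x xs))
      (AllPairs.++⁺ (reverse-allPairs⁺ Rxs) ([] ∷ []) (All.map (_∷ []) (reverse⁺ {P = R x} Rx)))

  ++⁻ : ∀ {A : Set} {R : A → A → Set} xs {ys} → AllPairs R (xs ++ ys) →
    AllPairs R xs × AllPairs R ys × All (λ x → All (R x) ys) xs
  ++⁻ []       pairs        = [] , pairs , []
  ++⁻ (x ∷ xs) (Rx ∷ pairs) with pxs , pys , cross ← ++⁻ xs pairs =
    All.++⁻ˡ xs Rx ∷ pxs , pys , All.++⁻ʳ xs Rx ∷ cross

  ++-comm⁺ : ∀ {A : Set} {R : A → A → Set} → (∀ {x y} → R x y → R y x) →
    ∀ xs {ys} → AllPairs R (xs ++ ys) → AllPairs R (ys ++ xs)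
  ++-comm⁺ R-sym xs pairs with pxs , pys , cross ← ++⁻ xs pairs =
    AllPairs.++⁺ pys pxs (All.map (All.map R-sym) (All.All-swap cross))

  module _ {X : Set} where

    assoc : ℕ → List (ℕ × X) → Maybe X
    assoc y []             = nothing
    assoc y ((k , x) ∷ ps) with y ℕ.≟ k
    ... | yes _ = just x
    ... | no  _ = assoc y ps

    assoc-≡ : ∀ {y k} x ps → y ≡ k → assoc y ((k , x) ∷ ps) ≡ just x
    assoc-≡ {y} {k} x ps y≡k with y ℕ.≟ k
    ... | yes _   = refl
    ... | no  y≢k = contradiction y≡k y≢k

    assoc-≢ : ∀ {y k} x ps → y ≢ k → assoc y ((k , x) ∷ ps) ≡ assoc y ps
    assoc-≢ {y} {k} x ps y≢k with y ℕ.≟ k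
    ... | yes y≡k = contradiction y≡k y≢k
    ... | no  _   = refl

    Absent : ℕ → List (ℕ × X) → Set
    Absent y = All (λ p → y ≢ proj₁ p)

    DistinctKeys Increasing : List (ℕ × X) → Set
    DistinctKeys = AllPairs (_≢_ on proj₁)
    Increasing   = AllPairs (_<_ on proj₁)

    absent⇒assoc≡nothing : ∀ {y ps} → Absent y ps → assoc y ps ≡ nothing
    absent⇒assoc≡nothing {ps = []}    []             = refl
    absent⇒assoc≡nothing {ps = p ∷ _} (y≢k ∷ absent) =
      trans (assoc-≢ (proj₂ p) _ y≢k) (absent⇒assoc≡nothing absent)

    assoc-++ : ∀ y ps qs → assoc y (ps ++ qs) ≡ (assoc y ps <∣> assoc y qs)
    assoc-++ y []             qs = refl
    assoc-++ y ((k , x) ∷ ps) qs with y ℕ.≟ k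
    ... | yes _ = refl
    ... | no  _ = assoc-++ y ps qs

    assoc-comm : ∀ {y ps qs} → Absent y ps ⊎ Absent y qs → assoc y (ps ++ qs) ≡ assoc y (qs ++ ps)
    assoc-comm {y} {ps} {qs} absent = trans (assoc-++ y ps qs) (trans (comm absent) (sym (assoc-++ y qs ps)))
      where
      <∣>-nothing : ∀ (m : Maybe X) → m ≡ (m <∣> nothing)
      <∣>-nothing (just _) = refl
      <∣>-nothing nothing  = refl
      comm : Absent y ps ⊎ Absent y qs → (assoc y ps <∣> assoc y qs) ≡ (assoc y qs <∣> assoc y ps)
      comm (inj₁ absent) rewrite absent⇒assoc≡nothing absent = <∣>-nothing (assoc y qs)
      comm (inj₂ absent) rewrite absent⇒assoc≡nothing absent = sym (<∣>-nothing (assoc y ps))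

    assoc-reverse : ∀ y {ps} → DistinctKeys ps → assoc y (reverse ps) ≡ assoc y ps
    assoc-reverse y {[]}           []                = refl
    assoc-reverse y {(k , x) ∷ ps} (k≢ ∷ distinct) = begin
      assoc y (reverse ((k , x) ∷ ps))     ≡⟨ cong (assoc y) (List.unfold-reverse (k , x) ps) ⟩
      assoc y (reverse ps ++ [ k , x ])    ≡⟨ assoc-comm absent ⟩
      assoc y ((k , x) ∷ reverse ps)       ≡⟨ assoc-++ y [ k , x ] (reverse ps) ⟩
      (assoc y [ k , x ] <∣> assoc y (reverse ps)) ≡⟨ cong (assoc y [ k , x ] <∣>_) (assoc-reverse y distinct) ⟩
      (assoc y [ k , x ] <∣> assoc y ps)   ≡⟨ assoc-++ y [ k , x ] ps ⟨
      assoc y ((k , x) ∷ ps)               ∎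
      where
      open ≡-Reasoning
      absent : Absent y (reverse ps) ⊎ Absent y [ k , x ]
      absent with y ℕ.≟ k
      ... | yes refl = inj₁ (reverse⁺ k≢)
      ... | no  y≢k  = inj₂ (y≢k ∷ [])

    Maps : ℕ → X → ℕ × X → Set
    Maps y x p = y ≡ proj₁ p × proj₂ p ≡ x

    assoc⁻ : ∀ {y x} ps → assoc y ps ≡ just x → Any (Maps y x) ps
    assoc⁻ {y} ((k , x) ∷ ps) eq with y ℕ.≟ k | eq
    ... | yes y≡k | refl = here (y≡k , refl)
    ... | no  _   | eq′  = there (assoc⁻ ps eq′)

    assoc⁺ : ∀ {y x ps} → DistinctKeys ps → Any (Maps y x) ps → assoc y ps ≡ just x
    assoc⁺ {ps = (_ , x) ∷ ps} (_ ∷ _) (here (y≡k , refl)) = assoc-≡ x ps y≡k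
    assoc⁺ {ps = (_ , x) ∷ ps} (k≢ ∷ distinct) (there found) =
      trans (assoc-≢ x ps (λ { refl → differs k≢ found })) (assoc⁺ distinct found)
      where
      differs : ∀ {y x ps} → Absent y ps → ¬ Any (Maps y x) ps
      differs (y≢k ∷ _)    (here (y≡k , _)) = y≢k y≡k
      differs (_ ∷ absent) (there found)    = differs absent found

    <+-suc : ∀ a n {q} → q < a + suc n → q < suc a + n
    <+-suc a n {q} = subst (q <_) (ℕ.+-suc a n)

    -- Turns the natural ordering of a line into the order of keys: a scan of positions meets
    -- increasing keys in list order. The start `a` is a parameter so that the induction moves the
    -- window and leaves the keys alone.
    catMaybes-assoc : ∀ {k} a {ps} → Increasing ps → All (λ p → a ≤ proj₁ p × proj₁ p < a + k) ps →
      (h : Fin k → Maybe X) → (∀ i → h i ≡ assoc (a + toℕ i) ps) → catMaybes (tabulate h) ≡ map proj₂ ps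
    catMaybes-assoc {zero} a {[]} _ _ _ _ = refl
    catMaybes-assoc {zero} a {_ ∷ _} _ ((a≤k , k<a+0) ∷ _) _ _ =
      contradiction (subst (_ <_) (ℕ.+-identityʳ a) k<a+0) (ℕ.≤⇒≯ a≤k)
    catMaybes-assoc {suc n} a {[]} _ _ h h≡ rewrite h≡ zero = catMaybes-assoc {n} (suc a) {[]} [] [] (h ∘ suc) (h≡ ∘ suc)
    catMaybes-assoc {suc n} a {(k , x) ∷ ps} (k< ∷ inc) ((a≤k , k<a+n) ∷ bounds) h h≡ with a ℕ.≟ k
    ... | yes refl rewrite trans (h≡ zero) (assoc-≡ x ps (ℕ.+-identityʳ a)) =
      cong (x ∷_) (catMaybes-assoc {n} (suc a) inc
        (All.zipWith (λ { (a<q , _ , q<) → a<q , <+-suc a n q< }) (k< , bounds))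
        (h ∘ suc) (λ i → trans (h≡ (suc i)) (trans
          (assoc-≢ x ps (λ eq → ℕ.m≢1+m+n a (trans (sym eq) (ℕ.+-suc a (toℕ i)))))
          (cong (λ y → assoc y ps) (ℕ.+-suc a (toℕ i))))))
    ... | no a≢k rewrite trans (h≡ zero) (absent⇒assoc≡nothing {a + 0} {(k , x) ∷ ps}
          (subst (λ a → All (λ p → a ≢ proj₁ p) ((k , x) ∷ ps)) (sym (ℕ.+-identityʳ a))
            (a≢k ∷ All.map (λ k<q → ℕ.<⇒≢ (ℕ.≤-<-trans a≤k k<q)) k<))) =
      catMaybes-assoc {n} (suc a) (k< ∷ inc)
        ((ℕ.≤∧≢⇒< a≤k a≢k , <+-suc a n k<a+n) ∷
          All.zipWith (λ { (k<q , _ , q<) → ℕ.≤-<-trans a≤k k<q , <+-suc a n q< }) (k< , bounds))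
        (h ∘ suc) (λ i → trans (h≡ (suc i)) (cong (λ y → assoc y ((k , x) ∷ ps)) (ℕ.+-suc a (toℕ i))))

    split-increasing : ∀ n ps → Increasing ps →
      ∃₂ λ us ws → ps ≡ us ++ ws × All (λ p → proj₁ p < n) us × All (λ p → n ≤ proj₁ p) ws
    split-increasing n [] [] = [] , [] , refl , [] , []
    split-increasing n (p ∷ ps) (k< ∷ inc) with proj₁ p ℕ.<? n
    ... | no  k≮n = [] , p ∷ ps , refl , [] , ℕ.≮⇒≥ k≮n ∷ All.map (λ k<q → ℕ.≤-trans (ℕ.≮⇒≥ k≮n) (ℕ.<⇒≤ k<q)) k<
    ... | yes k<n with us , ws , refl , <n , ≥n ← split-increasing n ps inc = p ∷ us , ws , refl , k<n ∷ <n , ≥n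

    -- Keys in a window of length n wrap around at most once. Those from n on drop below `b` and so
    -- precede all the others, which merely rotates the list.
    catMaybes-assoc-cyclic : ∀ {n} .{{_ : NonZero n}} {b} ps → b ≤ n → Increasing ps →
      All (λ p → b ≤ proj₁ p × proj₁ p < b + n) ps →
      (h : Fin n → Maybe X) → (∀ i → h i ≡ assoc (toℕ i) (map (map₁ (_% n)) ps)) →
      ∃₂ λ xs ys → map proj₂ ps ≡ xs ++ ys × catMaybes (tabulate h) ≡ ys ++ xs
    catMaybes-assoc-cyclic {n} {b} ps b≤n inc bounds h h≡
      with us , ws , refl , us<n , n≤ws ← split-increasing n ps inc =
      map proj₂ us , map proj₂ ws , List.map-++ proj₂ us ws , (begin
        catMaybes (tabulate h)                     ≡⟨ catMaybes-assoc 0 increasing bounded h h≡′ ⟩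
        map proj₂ (map (map₁ (_∸ n)) ws ++ us)     ≡⟨ List.map-++ proj₂ (map (map₁ (_∸ n)) ws) us ⟩
        map proj₂ (map (map₁ (_∸ n)) ws) ++ map proj₂ us ≡⟨ cong (_++ map proj₂ us) (List.map-∘ ws) ⟨
        map proj₂ ws ++ map proj₂ us               ∎)
      where
      open ≡-Reasoning
      ws∸n = map (map₁ (_∸ n)) ws
      b≤us = All.++⁻ˡ us bounds
      ws<b+n = All.++⁻ʳ us bounds

      ∸n<b : ∀ {q} → q < b + n → n ≤ q → q ∸ n < b
      ∸n<b {q} q<b+n n≤q = subst (q ∸ n <_) (ℕ.m+n∸n≡m b n) (ℕ.∸-monoˡ-< q<b+n n≤q)

      ws∸n<b : All (λ p → proj₁ p < b) ws∸n
      ws∸n<b = All.map⁺ (All.zipWith (λ { ((_ , q<) , n≤q) → ∸n<b q< n≤q }) (ws<b+n , n≤ws))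

      shift : ∀ {ws} → Increasing ws → All (λ p → n ≤ proj₁ p) ws → AllPairs (_<_ on (λ p → proj₁ p ∸ n)) ws
      shift [] [] = []
      shift (k< ∷ inc) (n≤k ∷ n≤) = All.map (λ k<q → ℕ.∸-monoˡ-< k<q n≤k) k< ∷ shift inc n≤

      increasing : Increasing (ws∸n ++ us)
      increasing = AllPairs.++⁺ (AllPairs.map⁺ (shift (proj₁ (proj₂ (++⁻ us inc))) n≤ws)) (proj₁ (++⁻ us inc))
        (All.map (λ w<b → All.map (λ (b≤u , _) → ℕ.<-≤-trans w<b b≤u) b≤us) ws∸n<b)

      bounded : All (λ p → 0 ≤ proj₁ p × proj₁ p < n) (ws∸n ++ us)
      bounded = All.++⁺ (All.map (λ w<b → ℕ.z≤n , ℕ.<-≤-trans w<b b≤n) ws∸n<b) (All.map (λ u<n → ℕ.z≤n , u<n) us<n)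

      us%n : ∀ {us} → All (λ p → proj₁ p < n) us → map (map₁ (_% n)) us ≡ us
      us%n []           = refl
      us%n {u ∷ _} (u<n ∷ us<n) = cong₂ _∷_ (cong (_, proj₂ u) (m<n⇒m%n≡m u<n)) (us%n us<n)

      ws%n : ∀ {ws} → All (λ p → n ≤ proj₁ p × proj₁ p < b + n) ws → map (map₁ (_% n)) ws ≡ map (map₁ (_∸ n)) ws
      ws%n []           = refl
      ws%n {w ∷ _} ((n≤w , w<) ∷ ws<) = cong₂ _∷_ (cong (_, proj₂ w) (trans (sym (m≤n⇒[n∸m]%m≡n%m n≤w))
        (m<n⇒m%n≡m (ℕ.<-≤-trans (∸n<b w< n≤w) b≤n)))) (ws%n ws<)

      split-absent : ∀ y → Absent y us ⊎ Absent y ws∸n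
      split-absent y with y ℕ.<? b
      ... | yes y<b = inj₁ (All.map (λ (b≤u , _) → ℕ.<⇒≢ (ℕ.<-≤-trans y<b b≤u)) b≤us)
      ... | no  y≮b = inj₂ (All.map (λ w<b → ℕ.>⇒≢ (ℕ.<-≤-trans w<b (ℕ.≮⇒≥ y≮b))) ws∸n<b)

      h≡′ : ∀ i → h i ≡ assoc (toℕ i) (ws∸n ++ us)
      h≡′ i = begin
        h i                                                  ≡⟨ h≡ i ⟩
        assoc (toℕ i) (map (map₁ (_% n)) (us ++ ws))         ≡⟨ cong (assoc (toℕ i)) (List.map-++ (map₁ (_% n)) us ws) ⟩
        assoc (toℕ i) (map (map₁ (_% n)) us ++ map (map₁ (_% n)) ws)
          ≡⟨ cong (assoc (toℕ i)) (cong₂ _++_ (us%n us<n) (ws%n (All.zipWith (λ { ((_ , q<) , n≤q) → n≤q , q< }) (ws<b+n , n≤ws)))) ⟩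
        assoc (toℕ i) (us ++ ws∸n)                           ≡⟨ assoc-comm (split-absent (toℕ i)) ⟩
        assoc (toℕ i) (ws∸n ++ us)                           ∎

-- The subgroup of multiples of N and its order

module MultiplesSubgroup where

  open import Data.Bool.Base using (Bool; true; false; if_then_else_)
  open import Data.Nat.Base as ℕ using (ℕ; zero; suc; NonZero; _+_; _*_; _<_)
  import Data.Nat.Properties as ℕ
  open import Data.Nat.DivMod using (_mod_)
  open import Data.Nat.Divisibility using (_∣_; _∣?_; ∣m∣n⇒∣m+n; ∣m+n∣m⇒∣n; ∣-refl; _∣0; >⇒∤; %-presˡ-∣)
  open import Data.Fin.Base using (toℕ)
  open import Data.Fin.Properties using (toℕ-fromℕ<; toℕ<n)
  open import Data.Fin.Subset using (Subset; _∈_; ∣_∣)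
  open import Data.Vec.Base using (tabulate)
  open import Data.Vec.Properties using (lookup⇒[]=; []=⇒lookup; lookup∘tabulate)
  open import Function.Base using (_∘_)
  open import Function.Bundles using (mk⇔)
  open import Relation.Binary.PropositionalEquality
  open import Relation.Nullary using (Dec; does; yes)
  open import Relation.Nullary.Decidable using (dec-true; dec-false; does-⇔)

  -- Counting takes place over ℕ because there a range can be cut at N and shifted, unlike a
  -- `Subset` of fixed length.
  countBelow : (ℕ → Bool) → ℕ → ℕ
  countBelow f zero    = 0
  countBelow f (suc n) = (if f 0 then 1 else 0) + countBelow (f ∘ suc) n

  ∣tabulate∣ : ∀ f n → ∣ tabulate {n = n} (f ∘ toℕ) ∣ ≡ countBelow f n
  ∣tabulate∣ f zero = refl
  ∣tabulate∣ f (suc n) with f 0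
  ... | true  = cong suc (∣tabulate∣ (f ∘ suc) n)
  ... | false = ∣tabulate∣ (f ∘ suc) n

  countBelow-+ : ∀ f m n → countBelow f (m + n) ≡ countBelow f m + countBelow (f ∘ (m +_)) n
  countBelow-+ f zero    n = refl
  countBelow-+ f (suc m) n = trans (cong ((if f 0 then 1 else 0) +_) (countBelow-+ (f ∘ suc) m n))
    (sym (ℕ.+-assoc (if f 0 then 1 else 0) _ _))

  countBelow-cong : ∀ {f g} n → (∀ i → i < n → f i ≡ g i) → countBelow f n ≡ countBelow g n
  countBelow-cong zero    f≡g = refl
  countBelow-cong (suc n) f≡g =
    cong₂ (λ b k → (if b then 1 else 0) + k) (f≡g 0 ℕ.z<s) (countBelow-cong n λ i i<n → f≡g (suc i) (ℕ.s<s i<n))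

  countBelow-false : ∀ n → countBelow (λ _ → false) n ≡ 0
  countBelow-false zero    = refl
  countBelow-false (suc n) = countBelow-false n

  isMultiple : ℕ → ℕ → Bool
  isMultiple N i = does (N ∣? i)

  -- Divisibility by N has period N, and within one period only the first number is a multiple.
  countBelow-multiples : ∀ q N .{{_ : NonZero N}} → countBelow (isMultiple N) (q * N) ≡ q
  countBelow-multiples zero    N          = refl
  countBelow-multiples (suc q) N@(suc N-1) = trans (countBelow-+ (isMultiple N) N (q * N)) (cong₂ _+_
    (cong₂ (λ b k → (if b then 1 else 0) + k) (dec-true (N ∣? 0) (N ∣0))
      (trans (countBelow-cong N-1 λ i i<N-1 → dec-false (N ∣? suc i) (>⇒∤ (ℕ.s<s i<N-1))) (countBelow-false N-1)))
    (trans (countBelow-cong (q * N) periodic) (countBelow-multiples q N)))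
    where
    periodic : ∀ i → i < q * N → isMultiple N (N + i) ≡ isMultiple N i
    periodic i _ = does-⇔ (mk⇔ (λ N∣N+i → ∣m+n∣m⇒∣n N∣N+i ∣-refl) (∣m∣n⇒∣m+n ∣-refl)) (N ∣? (N + i)) (N ∣? i)

  module _ (N m : ℕ) where

    multiples : Subset m
    multiples = tabulate (isMultiple N ∘ toℕ)

    ∈multiples⁺ : ∀ {x} → N ∣ toℕ x → x ∈ multiples
    ∈multiples⁺ {x} N∣x = lookup⇒[]= x multiples
      (trans (lookup∘tabulate (isMultiple N ∘ toℕ) x) (dec-true (N ∣? toℕ x) N∣x))

    ∈multiples⁻ : ∀ {x} → x ∈ multiples → N ∣ toℕ x
    ∈multiples⁻ {x} x∈ = decided (N ∣? toℕ x)
      (trans (sym (lookup∘tabulate (isMultiple N ∘ toℕ) x)) ([]=⇒lookup x∈))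
      where
      decided : ∀ {P : Set} (P? : Dec P) → does P? ≡ true → P
      decided (yes p) _ = p

    module _ .{{_ : NonZero m}} where

      ∣mod : N ∣ m → ∀ {a} → N ∣ a → N ∣ toℕ (a mod m)
      ∣mod N∣m {a} N∣a = subst (N ∣_) (sym (toℕ-fromℕ< _)) (%-presˡ-∣ N∣a N∣m)

      multiples-isSubgroup : N ∣ m → IsSubgroup multiples
      multiples-isSubgroup N∣m = record
        { 𝟘∈       = ∈multiples⁺ (∣mod N∣m (N ∣0))
        ; ⊕-closed = λ x∈ y∈ → ∈multiples⁺ (∣mod N∣m (∣m∣n⇒∣m+n (∈multiples⁻ x∈) (∈multiples⁻ y∈)))
        ; ⊖-closed = λ {x} x∈ → ∈multiples⁺ (∣mod N∣m (∣m+n∣m⇒∣n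
            (subst (N ∣_) (sym (ℕ.m+[n∸m]≡n (ℕ.<⇒≤ (toℕ<n x)))) N∣m) (∈multiples⁻ x∈)))
        }

  multiples-order : ∀ q N .{{_ : NonZero N}} {m} → m ≡ q * N → ∣ multiples N m ∣ ≡ q
  multiples-order q N refl = trans (∣tabulate∣ (isMultiple N) (q * N)) (countBelow-multiples q N)

-- Arrays prescribed along their diagonals; rows and columns as rotations

module CyclicDiagonalArrays where

  open AssociationLists
  open import Data.Nat.Base as ℕ using (ℕ; zero; suc; NonZero; _+_; _∸_; _<_; _≤_)
  import Data.Nat.Properties as ℕ
  open import Data.Nat.DivMod using (_%_; m<n⇒m%n≡m; %-distribˡ-+; m%n%n≡m%n; [m+n]%n≡m%n)
  open import Data.Fin.Base as Fin using (Fin; zero; suc; toℕ; fromℕ<)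
  open import Data.Fin.Properties as Fin using (toℕ-fromℕ<; toℕ<n; toℕ-injective)
  open import Data.List.Base using (List; map; _++_; tabulate; reverse; allFin; catMaybes; mapMaybe)
  import Data.List.Properties as List
  open import Data.List.Relation.Unary.All as All using (All)
  import Data.List.Relation.Unary.All.Properties as All
  import Data.List.Relation.Unary.Any.Properties as Any
  open import Data.List.Relation.Unary.AllPairs as AllPairs using (AllPairs)
  import Data.List.Relation.Unary.AllPairs.Properties as AllPairs
  open import Data.Maybe.Base as Maybe using (Maybe; just; nothing)
  open import Data.Product.Base using (_×_; _,_; proj₁; proj₂; ∃; ∃₂; map₁)
  open import Data.Unit.Base using (tt)
  open import Data.Maybe using (Is-just)
  open import Data.Maybe.Relation.Unary.Any using (just)
  open import Data.Maybe.Relation.Unary.All using (just)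
  open import Function.Base using (_∘_; id)
  open import Function.Bundles using (mk⇔)
  open import Relation.Binary.PropositionalEquality
  open import Relation.Binary.Definitions using (tri<; tri≈; tri>)
  open import Relation.Nullary using (yes; no; contradiction)

  %-+-cancel : ∀ {a b x n} .{{_ : NonZero n}} → x < n → a + b ≡ x + n → (a % n + b) % n ≡ x
  %-+-cancel {a} {b} {x} {n} x<n a+b≡x+n = begin
    (a % n + b) % n             ≡⟨ %-distribˡ-+ (a % n) b n ⟩
    (a % n % n + b % n) % n     ≡⟨ cong (λ r → (r + b % n) % n) (m%n%n≡m%n a n) ⟩
    (a % n + b % n) % n         ≡⟨ %-distribˡ-+ a b n ⟨
    (a + b) % n                 ≡⟨ cong (_% n) a+b≡x+n ⟩
    (x + n) % n                 ≡⟨ [m+n]%n≡m%n x n ⟩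
    x % n                       ≡⟨ m<n⇒m%n≡m x<n ⟩
    x                           ∎
    where open ≡-Reasoning

  -- Allows the key to change from a row index to a column index. `from` makes a miss on the left a
  -- miss on the right, so both lookups stop at the same `k`.
  assoc-tabulate-cong : ∀ {K} {X : Set} {y y′} (f g : Fin K → ℕ × X) →
    (∀ k → y ≡ proj₁ (f k) → y′ ≡ proj₁ (g k) × proj₂ (f k) ≡ proj₂ (g k)) →
    (∀ k → y′ ≡ proj₁ (g k) → y ≡ proj₁ (f k)) →
    assoc y (tabulate f) ≡ assoc y′ (tabulate g)
  assoc-tabulate-cong {zero}                    f g to from = refl
  assoc-tabulate-cong {suc K} {y = y} {y′ = y′} f g to from with y ℕ.≟ proj₁ (f zero)
  ... | yes y≡k with y′≡k , x≡ ← to zero y≡k =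
    trans (cong just x≡) (sym (assoc-≡ (proj₂ (g zero)) (tabulate (g ∘ suc)) y′≡k))
  ... | no  y≢k =
    trans (assoc-tabulate-cong (f ∘ suc) (g ∘ suc) (to ∘ suc) (from ∘ suc))
      (sym (assoc-≢ (proj₂ (g zero)) (tabulate (g ∘ suc)) (y≢k ∘ from zero)))

  module Diagonals {K n : ℕ} .{{_ : NonZero n}} {X : Set}
    (offset : Fin K → ℕ)
    (offset-mono-< : ∀ {j k} → j Fin.< k → offset j < offset k)
    (offset<n : ∀ k → offset k < n)
    (value : Fin K → ℕ → X)
    where

    cells : ℕ → List (ℕ × X)
    cells c = tabulate λ k → (offset k + c) % n , value k c

    array : PFArray n X
    array r c = assoc (toℕ r) (cells (toℕ c))

    offset-injective : ∀ {j k} → offset j ≡ offset k → j ≡ k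
    offset-injective {j} {k} eq with Fin.<-cmp j k
    ... | tri< j<k _ _ = contradiction eq (ℕ.<⇒≢ (offset-mono-< j<k))
    ... | tri≈ _ j≡k _ = j≡k
    ... | tri> _ _ k<j = contradiction (sym eq) (ℕ.<⇒≢ (offset-mono-< k<j))

    cells-distinct : ∀ c → DistinctKeys (cells c)
    cells-distinct c = AllPairs.tabulate⁺-< λ {j} {k} j<k → window⇒%≢ {offset j + c} {offset k + c} {n}
      (ℕ.+-monoˡ-< c (offset-mono-< j<k))
      (begin-strict
        offset k + c     <⟨ ℕ.+-monoˡ-< c (offset<n k) ⟩
        n + c            ≤⟨ ℕ.+-monoʳ-≤ n (ℕ.m≤n+m c (offset j)) ⟩
        n + (offset j + c) ≡⟨ ℕ.+-comm n (offset j + c) ⟩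
        offset j + c + n ∎)
      where open ℕ.≤-Reasoning

    array⁺ : ∀ {r c} k → toℕ r ≡ (offset k + toℕ c) % n → array r c ≡ just (value k (toℕ c))
    array⁺ {r} {c} k r≡ = assoc⁺ (cells-distinct (toℕ c)) (Any.tabulate⁺ k (r≡ , refl))

    array⁻ : ∀ {r c x} → array r c ≡ just x → ∃ λ k → toℕ r ≡ (offset k + toℕ c) % n × value k (toℕ c) ≡ x
    array⁻ {r} {c} eq = Any.tabulate⁻ (assoc⁻ (cells (toℕ c)) eq)

    private
      mapMaybe-allFin : ∀ {m} (h : Fin m → Maybe X) → mapMaybe h (allFin m) ≡ catMaybes (tabulate h)
      mapMaybe-allFin h = cong catMaybes (List.map-tabulate id h)

    -- Before reduction modulo n, diagonal k meets column c in row offset k + c. These numbers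
    -- increase with k and stay in the window [c, c + n).
    column-rotation : ∀ c → ∃₂ λ xs ys → tabulate (λ k → value k (toℕ c)) ≡ xs ++ ys × column array c ≡ ys ++ xs
    column-rotation c =
      let xs , ys , zs≡ , column≡ = catMaybes-assoc-cyclic ps (ℕ.<⇒≤ (toℕ<n c)) increasing bounds (λ r → array r c) cells≡
      in xs , ys , trans (sym (List.map-tabulate f proj₂)) zs≡ , trans (mapMaybe-allFin λ r → array r c) column≡
      where
      f : Fin K → ℕ × X
      f k = offset k + toℕ c , value k (toℕ c)
      ps : List (ℕ × X)
      ps = tabulate f
      increasing : Increasing ps
      increasing = AllPairs.tabulate⁺-< λ j<k → ℕ.+-monoˡ-< (toℕ c) (offset-mono-< j<k)
      bounds : All (λ q → toℕ c ≤ proj₁ q × proj₁ q < toℕ c + n) ps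
      bounds = All.tabulate⁺ λ k → ℕ.m≤n+m (toℕ c) (offset k) ,
        subst (_< toℕ c + n) (ℕ.+-comm (toℕ c) (offset k)) (ℕ.+-monoʳ-< (toℕ c) (offset<n k))
      cells≡ : ∀ r → array r c ≡ assoc (toℕ r) (map (map₁ (_% n)) ps)
      cells≡ r = cong (assoc (toℕ r)) (sym (List.map-tabulate f (map₁ (_% n))))

    columnOf : ℕ → Fin K → ℕ
    columnOf r k = (r + (n ∸ offset k)) % n

    -- Along a row the column r - offset k falls as k grows, so the natural ordering runs through
    -- the diagonals backwards, up to rotation.
    row-rotation : ∀ r → ∃₂ λ xs ys →
      reverse (tabulate λ k → value k (columnOf (toℕ r) k)) ≡ xs ++ ys × row array r ≡ ys ++ xs
    row-rotation r =
      let xs , ys , zs≡ , row≡ = catMaybes-assoc-cyclic ps (toℕ<n r) increasing bounds (array r) cells≡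
      in xs , ys , trans (sym values≡) zs≡ , trans (mapMaybe-allFin (array r)) row≡
      where
      f g : Fin K → ℕ × X
      f k = toℕ r + (n ∸ offset k) , value k (columnOf (toℕ r) k)
      g = map₁ (_% n) ∘ f
      ps : List (ℕ × X)
      ps = reverse (tabulate f)

      values≡ : map proj₂ ps ≡ reverse (tabulate λ k → value k (columnOf (toℕ r) k))
      values≡ = trans (List.reverse-map proj₂ (tabulate f)) (cong reverse (List.map-tabulate f proj₂))

      decreasing : ∀ {j k} → j Fin.< k → proj₁ (f k) < proj₁ (f j)
      decreasing {j} {k} j<k = ℕ.+-monoʳ-< (toℕ r) (ℕ.∸-monoʳ-< (offset-mono-< j<k) (ℕ.<⇒≤ (offset<n k)))

      increasing : Increasing ps
      increasing = reverse-allPairs⁺ (AllPairs.tabulate⁺-< decreasing)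

      -- The window is [r + 1, r + n] and not [r, r + n - 1]: offset 0 contributes r + n, and every
      -- offset is below n.
      ≥1+r : ∀ k → suc (toℕ r) ≤ proj₁ (f k)
      ≥1+r k = subst (suc (toℕ r) ≤_) (ℕ.+-comm (n ∸ offset k) (toℕ r)) (ℕ.+-monoˡ-≤ (toℕ r) (ℕ.m<n⇒0<n∸m (offset<n k)))

      <1+r+n : ∀ k → proj₁ (f k) < suc (toℕ r) + n
      <1+r+n k = ℕ.s≤s (ℕ.+-monoʳ-≤ (toℕ r) (ℕ.m∸n≤m n (offset k)))

      bounds : All (λ q → suc (toℕ r) ≤ proj₁ q × proj₁ q < suc (toℕ r) + n) ps
      bounds = reverse⁺ (All.tabulate⁺ λ k → ≥1+r k , <1+r+n k)

      distinct : DistinctKeys (tabulate g)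
      distinct = AllPairs.tabulate⁺-< λ {j} {k} j<k → window⇒%≢ {proj₁ (f k)} {proj₁ (f j)} (decreasing j<k)
        (ℕ.<-≤-trans (<1+r+n j) (ℕ.+-monoˡ-≤ n (≥1+r k))) ∘ sym

      to : ∀ c k → toℕ r ≡ (offset k + toℕ c) % n → toℕ c ≡ columnOf (toℕ r) k
      to c k r≡ = sym (trans (cong (λ r → (r + (n ∸ offset k)) % n) r≡)
        (%-+-cancel {offset k + toℕ c} {n ∸ offset k} (toℕ<n c) (begin
          offset k + toℕ c + (n ∸ offset k)   ≡⟨ cong (_+ (n ∸ offset k)) (ℕ.+-comm (offset k) (toℕ c)) ⟩
          toℕ c + offset k + (n ∸ offset k)   ≡⟨ ℕ.+-assoc (toℕ c) (offset k) (n ∸ offset k) ⟩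
          toℕ c + (offset k + (n ∸ offset k)) ≡⟨ cong (toℕ c +_) (ℕ.m+[n∸m]≡n (ℕ.<⇒≤ (offset<n k))) ⟩
          toℕ c + n                           ∎)))
        where open ≡-Reasoning

      from : ∀ c k → toℕ c ≡ columnOf (toℕ r) k → toℕ r ≡ (offset k + toℕ c) % n
      from c k c≡ = sym (begin
        (offset k + toℕ c) % n               ≡⟨ cong (λ c → (offset k + c) % n) c≡ ⟩
        (offset k + columnOf (toℕ r) k) % n  ≡⟨ cong (_% n) (ℕ.+-comm (offset k) (columnOf (toℕ r) k)) ⟩
        (columnOf (toℕ r) k + offset k) % n  ≡⟨ %-+-cancel {toℕ r + (n ∸ offset k)} {offset k} (toℕ<n r)
          (trans (ℕ.+-assoc (toℕ r) (n ∸ offset k) (offset k)) (cong (toℕ r +_) (ℕ.m∸n+n≡m (ℕ.<⇒≤ (offset<n k))))) ⟩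
        toℕ r                                ∎)
        where open ≡-Reasoning

      cells≡ : ∀ c → array r c ≡ assoc (toℕ c) (map (map₁ (_% n)) ps)
      cells≡ c = begin
        assoc (toℕ r) (cells (toℕ c))                ≡⟨ assoc-tabulate-cong (λ k → (offset k + toℕ c) % n , value k (toℕ c)) g (λ k r≡ → to c k r≡ , cong (value k) (to c k r≡)) (from c) ⟩
        assoc (toℕ c) (tabulate g)                   ≡⟨ assoc-reverse (toℕ c) distinct ⟨
        assoc (toℕ c) (reverse (tabulate g))         ≡⟨ cong (assoc (toℕ c) ∘ reverse) (List.map-tabulate f (map₁ (_% n))) ⟨
        assoc (toℕ c) (reverse (map (map₁ (_% n)) (tabulate f))) ≡⟨ cong (assoc (toℕ c)) (List.reverse-map (map₁ (_% n)) (tabulate f)) ⟨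
        assoc (toℕ c) (map (map₁ (_% n)) ps)         ∎
        where open ≡-Reasoning

    module _ {Y : Set} (g : X → Y) where

      private
        A : PFArray n Y
        A r c = Maybe.map g (array r c)

      row-map : ∀ r → row A r ≡ map g (row array r)
      row-map r = trans (cong catMaybes (List.map-∘ (allFin n))) (sym (List.map-catMaybes g (map (array r) (allFin n))))

      column-map : ∀ c → column A c ≡ map g (column array c)
      column-map c = trans (cong catMaybes (List.map-∘ (allFin n)))
        (sym (List.map-catMaybes g (map (λ r → array r c) (allFin n))))

      cell⁺ : ∀ {r c} k → toℕ r ≡ (offset k + toℕ c) % n → A r c ≡ just (g (value k (toℕ c)))
      cell⁺ {r} {c} k r≡ = cong (Maybe.map g) (array⁺ {r} {c} k r≡)

      cell⁻ : ∀ {r c y} → A r c ≡ just y → ∃ λ k → toℕ r ≡ (offset k + toℕ c) % n × g (value k (toℕ c)) ≡ y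
      cell⁻ {r} {c} eq with array r c in array≡
      cell⁻ {r} {c} refl | just x with k , r≡ , refl ← array⁻ {r} {c} array≡ = k , r≡ , refl

      offsetFin : Fin K → Fin n
      offsetFin k = fromℕ< (offset<n k)

      toℕ-⊕ : ∀ k c → toℕ (offsetFin k ⊕ c) ≡ (offset k + toℕ c) % n
      toℕ-⊕ k c = trans (toℕ-fromℕ< _) (cong (λ o → (o + toℕ c) % n) (toℕ-fromℕ< (offset<n k)))

      isDiagonal : IsDiagonal A K
      isDiagonal = offsetFin ,
        (λ {j} {k} eq → offset-injective (trans (sym (toℕ-fromℕ< (offset<n j))) (trans (cong toℕ eq) (toℕ-fromℕ< (offset<n k))))) ,
        λ r c → mk⇔ (to r c) (from r c)
        where
        to : ∀ r c → Is-just (A r c) → ∃ λ k → OnDiagonal (offsetFin k) r c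
        to r c filled with A r c in eq
        to r c (just _) | just y with k , r≡ , _ ← cell⁻ {r} {c} eq = k , toℕ-injective (trans r≡ (sym (toℕ-⊕ k c)))
        from : ∀ r c → (∃ λ k → OnDiagonal (offsetFin k) r c) → Is-just (A r c)
        from r c (k , r≡) rewrite cell⁺ {r} {c} k (trans (cong toℕ r≡) (toℕ-⊕ k c)) = just tt

      private
        0-column : Fin n
        0-column = fromℕ< (ℕ.>-nonZero⁻¹ n)

        toℕ-⊕0 : ∀ (d : Fin n) → toℕ (d ⊕ 0-column) ≡ toℕ d
        toℕ-⊕0 d = trans (toℕ-fromℕ< _) (trans (cong (_% n) (trans (cong (toℕ d +_) (toℕ-fromℕ< _)) (ℕ.+-identityʳ (toℕ d)))) (m<n⇒m%n≡m (toℕ<n d)))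

        offset+0 : ∀ k → (offset k + toℕ 0-column) % n ≡ offset k
        offset+0 k = trans (cong (_% n) (trans (cong (offset k +_) (toℕ-fromℕ< _)) (ℕ.+-identityʳ (offset k)))) (m<n⇒m%n≡m (offset<n k))

      -- One cell decides: in column 0 the diagonal d sits in row d.
      filledDiagonal⁻ : ∀ {d} → FilledDiagonal A d → ∃ λ k → toℕ d ≡ offset k
      filledDiagonal⁻ {d} filled with A (d ⊕ 0-column) 0-column in eq | filled (d ⊕ 0-column) 0-column refl
      ... | just y | _ with k , d≡ , _ ← cell⁻ {d ⊕ 0-column} {0-column} eq =
        k , trans (sym (toℕ-⊕0 d)) (trans d≡ (offset+0 k))

      emptyDiagonal⁻ : ∀ {d} → EmptyDiagonal A d → ∀ k → toℕ d ≢ offset k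
      emptyDiagonal⁻ {d} empty k d≡ with A (d ⊕ 0-column) 0-column in eq | empty (d ⊕ 0-column) 0-column refl
      ... | just _  | just ()
      ... | nothing | _ with () ← trans (sym eq) (cell⁺ {d ⊕ 0-column} {0-column} k
        (trans (toℕ-⊕0 d) (trans d≡ (sym (offset+0 k)))))

-- Verified tests for integers that are piecewise affine in p and a position x

module AffineForms where

  open import Data.Bool.Base using (if_then_else_)
  open import Data.Nat.Base as ℕ using (ℕ)
  open import Data.Integer.Base using (ℤ; +_; -[1+_]; -_; _+_; _-_; _*_; _≤_; _<_; 0ℤ; 1ℤ; -1ℤ; +≤+; ∣_∣; nonNegative; NonNegative)
  import Data.Integer.Properties as ℤ
  import Data.Integer.DivMod as ℤ
  open import Data.Fin.Base using (Fin; zero; suc)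
  import Data.List.Relation.Unary.All as All
  import Data.List.Relation.Unary.All.Properties as All
  import Data.List.Relation.Unary.AllPairs as AllPairs
  import Data.List.Relation.Unary.AllPairs.Properties as AllPairs
  open import Relation.Binary.Definitions using (DecidableEquality)
  open import Relation.Nullary.Decidable using (map′; _×-dec_)
  open import Data.Integer.Divisibility.Signed using (_∣_; divides)
  open import Data.Integer.Tactic.RingSolver using (solve-∀)
  open import Data.List.Base using (List; []; _∷_; map; tabulate; reverse)
  import Data.List.Properties as List
  open import Data.List.Relation.Unary.All using (All; []; _∷_)
  open import Data.List.Relation.Unary.AllPairs using (AllPairs; []; _∷_)
  open import Data.Maybe.Base as Maybe using (Maybe; just; nothing; _>>=_; _<∣>_)
  open import Data.Product.Base using (_×_; _,_; ∃)
  open import Data.Sum.Base as Sum using (_⊎_; inj₁; inj₂)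
  open import Relation.Binary.PropositionalEquality
  open import Relation.Nullary using (¬_; yes; no; does)
  open import Relation.Nullary.Decidable.Core using (dec⇒maybe)
  open import Relation.Nullary.Decidable using (dec-true; dec-false)
  open import Relation.Nullary.Negation using (contradiction)

  -- form α β γ stands for α + β p + γ x, where x ranges over an interval.
  record Form : Set where
    constructor form
    field const coeffₚ coeffₓ : ℤ

  infixl 6 _⊞_ _⊟_
  _⊞_ _⊟_ : Form → Form → Form
  form α β γ ⊞ form α′ β′ γ′ = form (α + α′) (β + β′) (γ + γ′)
  form α β γ ⊟ form α′ β′ γ′ = form (α - α′) (β - β′) (γ - γ′)

  neg : Form → Form
  neg f = form 0ℤ 0ℤ 0ℤ ⊟ f

  -- Freezes x at 0, so that a bound independent of the position can be compared with a form at
  -- every x.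
  atOrigin : Form → Form
  atOrigin f = record f { coeffₓ = 0ℤ }

  infixr 9 _⊚_
  _⊚_ : Form → Form → Form
  form α β γ ⊚ form α′ β′ γ′ = form (α + γ * α′) (β + γ * β′) (γ * γ′)

  𝟎 𝟏 X : Form
  𝟎 = form 0ℤ 0ℤ 0ℤ
  𝟏 = form 1ℤ 0ℤ 0ℤ
  X  = form 0ℤ 0ℤ 1ℤ

  ∑F : List Form → Form
  ∑F [] = 𝟎
  ∑F (f ∷ fs) = f ⊞ ∑F fs

  prefixSumsF : Form → List Form → List Form
  prefixSumsF a []       = []
  prefixSumsF a (f ∷ fs) = a ⊞ f ∷ prefixSumsF (a ⊞ f) fs

  prefixSums : ℤ → List ℤ → List ℤ
  prefixSums a []       = []
  prefixSums a (x ∷ xs) = a + x ∷ prefixSums (a + x) xs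

  -- As the sum is zero, the incongruence of the partial sums is preserved by rotations.
  record CyclicallySimple (V : ℤ) (zs : List ℤ) : Set where
    field
      sum≡0    : ∑ℤ zs ≡ 0ℤ
      prefixes : AllPairs (λ a b → ¬ V ∣ a - b) (prefixSums 0ℤ zs)

  infixr 5 _below_else_
  data Piecewise : Set where
    always       : Form → Piecewise
    _below_else_ : Form → Form → Piecewise → Piecewise

  infix 4 _≟F_
  _≟F_ : DecidableEquality Form
  form α β γ ≟F form α′ β′ γ′ =
    map′ (λ { (refl , refl , refl) → refl }) (λ { refl → refl , refl , refl })
      (α ℤ.≟ α′ ×-dec β ℤ.≟ β′ ×-dec γ ℤ.≟ γ′)

  module _ {A : Set} where

    all? : ∀ {P : A → Set} → (∀ x → Maybe (P x)) → ∀ xs → Maybe (All P xs)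
    all? P? []       = just []
    all? P? (x ∷ xs) = do
      px  ← P? x
      pxs ← all? P? xs
      just (px ∷ pxs)

    allPairs? : ∀ {R : A → A → Set} → (∀ x y → Maybe (R x y)) → ∀ xs → Maybe (AllPairs R xs)
    allPairs? R? []       = just []
    allPairs? R? (x ∷ xs) = do
      px  ← all? (R? x) xs
      pxs ← allPairs? R? xs
      just (px ∷ pxs)

    first? : ∀ {P : Set} → (A → Maybe P) → List A → Maybe P
    first? P? []       = nothing
    first? P? (x ∷ xs) = P? x <∣> first? P? xs

  between⇒∤ : ∀ {V z} q .{{_ : NonNegative V}} → q * V < z → z < (1ℤ + q) * V → ¬ V ∣ z
  between⇒∤ {V} q qV<z z<[1+q]V (divides r refl) =
    ℤ.<-irrefl refl (ℤ.<-≤-trans r<1+q (ℤ.i<j⇒suc[i]≤j q<r))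
    where
    q<r : q < r
    q<r = ℤ.*-cancelʳ-<-nonNeg V qV<z
    r<1+q : r < 1ℤ + q
    r<1+q = ℤ.*-cancelʳ-<-nonNeg V z<[1+q]V

  -- A pair (g , h) stands for the composite x ↦ h (g x): g finds the column, h the entry in it.
  Line : Set
  Line = List (Piecewise × Piecewise)

  -- Where the x-th integer of a segment occurs up to sign: it is a multiple of N, or it lies
  -- on diagonal k in column f(x), or the cases x = 2y and x = 2y + 1 are treated separately.
  data Witness (k : ℕ) : Set where
    multiple    : ℤ → Witness k
    single      : Fin k → Form → Witness k
    alternating : Witness k → Witness k → Witness k

  module Semantics (p : ℕ) where

    ⟦_⟧ : Form → ℤ → ℤ
    ⟦ form α β γ ⟧ x = α + β * + p + γ * x

    ⟦⊞⟧ : ∀ f g x → ⟦ f ⊞ g ⟧ x ≡ ⟦ f ⟧ x + ⟦ g ⟧ x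
    ⟦⊞⟧ (form α β γ) (form α′ β′ γ′) x = lemma α β γ α′ β′ γ′ (+ p) x
      where
      lemma : ∀ α β γ α′ β′ γ′ P x → α + α′ + (β + β′) * P + (γ + γ′) * x ≡ α + β * P + γ * x + (α′ + β′ * P + γ′ * x)
      lemma = solve-∀

    ⟦⊟⟧ : ∀ f g x → ⟦ f ⊟ g ⟧ x ≡ ⟦ f ⟧ x - ⟦ g ⟧ x
    ⟦⊟⟧ (form α β γ) (form α′ β′ γ′) x = lemma α β γ α′ β′ γ′ (+ p) x
      where
      lemma : ∀ α β γ α′ β′ γ′ P x → α - α′ + (β - β′) * P + (γ - γ′) * x ≡ α + β * P + γ * x - (α′ + β′ * P + γ′ * x)
      lemma = solve-∀

    ⟦⊚⟧ : ∀ f g x → ⟦ f ⊚ g ⟧ x ≡ ⟦ f ⟧ (⟦ g ⟧ x)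
    ⟦⊚⟧ (form α β γ) (form α′ β′ γ′) x = lemma α β γ α′ β′ γ′ (+ p) x
      where
      lemma : ∀ α β γ α′ β′ γ′ P x → α + γ * α′ + (β + γ * β′) * P + γ * γ′ * x ≡ α + β * P + γ * (α′ + β′ * P + γ′ * x)
      lemma = solve-∀

    ⟦neg⟧ : ∀ f x → ⟦ neg f ⟧ x ≡ - ⟦ f ⟧ x
    ⟦neg⟧ f x = trans (⟦⊟⟧ 𝟎 f x) (ℤ.+-identityˡ (- ⟦ f ⟧ x))

    ⟦atOrigin⟧ : ∀ f x → ⟦ atOrigin f ⟧ x ≡ ⟦ f ⟧ 0ℤ
    ⟦atOrigin⟧ (form α β γ) x = cong (λ z → α + β * + p + z) (sym (ℤ.*-zeroʳ γ))

    eval : Piecewise → ℤ → ℤ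
    eval (always f) x = ⟦ f ⟧ x
    eval (f below b else g) x = if does (x ℤ.<? ⟦ b ⟧ x) then ⟦ f ⟧ x else eval g x

    module Ranged (last : Form) where

      record InRange (x : ℤ) : Set where
        constructor inRange
        field
          nonneg : 0ℤ ≤ x
          ≤last  : x ≤ ⟦ last ⟧ 0ℤ

      -- An affine function is nonnegative on [0 , last] when it is so at the end it increases from.
      nonneg? : ∀ f → Maybe (∀ {x} → InRange x → 0ℤ ≤ ⟦ f ⟧ x)
      nonneg? f@(form α β γ) = ascending <∣> descending
        where
        p≥0 : 0ℤ ≤ + p
        p≥0 = +≤+ ℕ.z≤n
        nn : ∀ {i j} → 0ℤ ≤ i → 0ℤ ≤ j → 0ℤ ≤ i * j
        nn {i} {j} i≥0 j≥0 = subst (_≤ i * j) (ℤ.*-zeroʳ i) (ℤ.*-monoˡ-≤-nonNeg i {{nonNegative i≥0}} j≥0)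
        nn+ : ∀ {i j} → 0ℤ ≤ i → 0ℤ ≤ j → 0ℤ ≤ i + j
        nn+ = ℤ.+-mono-≤
        sum≥0 : ∀ {α β γ x} → 0ℤ ≤ α → 0ℤ ≤ β → 0ℤ ≤ γ → 0ℤ ≤ x → 0ℤ ≤ α + β * + p + γ * x
        sum≥0 α≥0 β≥0 γ≥0 x≥0 = nn+ (nn+ α≥0 (nn β≥0 p≥0)) (nn γ≥0 x≥0)
        ascending = do
          α≥0 ← dec⇒maybe (0ℤ ℤ.≤? α)
          β≥0 ← dec⇒maybe (0ℤ ℤ.≤? β)
          γ≥0 ← dec⇒maybe (0ℤ ℤ.≤? γ)
          just λ { (inRange x≥0 _) → sum≥0 α≥0 β≥0 γ≥0 x≥0 }
        α′ = Form.const last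
        β′ = Form.coeffₚ last
        γ′ = Form.coeffₓ last
        reflect : ∀ α β γ α′ β′ γ′ P x →
          α + γ * α′ + (β + γ * β′) * P + (- γ) * (α′ + β′ * P + γ′ * 0ℤ - x) ≡ α + β * P + γ * x
        reflect = solve-∀
        -- In terms of y = last - x the form has coefficients α + γα′, β + γβ′ and -γ, and the
        -- ascending test applies to these.
        descending = do
          a≥0 ← dec⇒maybe (0ℤ ℤ.≤? (α + γ * α′))
          b≥0 ← dec⇒maybe (0ℤ ℤ.≤? (β + γ * β′))
          g≥0 ← dec⇒maybe (0ℤ ℤ.≤? (- γ))
          just λ { {x} (inRange _ x≤) →
            subst (0ℤ ≤_) (reflect α β γ α′ β′ γ′ (+ p) x)
              (sum≥0 a≥0 b≥0 g≥0 (ℤ.i≤j⇒0≤j-i x≤)) }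

      ≤? : ∀ f g → Maybe (∀ {x} → InRange x → ⟦ f ⟧ x ≤ ⟦ g ⟧ x)
      ≤? f g = do
        g-f≥0 ← nonneg? (g ⊟ f)
        just λ {x} x∈ → ℤ.0≤i-j⇒j≤i (subst (0ℤ ≤_) (⟦⊟⟧ g f x) (g-f≥0 x∈))

      -- Equality on the range, not of coefficients: on a segment with a single point the
      -- coefficients of x may differ, as they do at each multiple of N in `valueTable`.
      ≈? : ∀ f g → Maybe (∀ {x} → InRange x → ⟦ f ⟧ x ≡ ⟦ g ⟧ x)
      ≈? f g = do
        f≤g ← ≤? f g
        g≤f ← ≤? g f
        just λ x∈ → ℤ.≤-antisym (f≤g x∈) (g≤f x∈)

      <? : ∀ f g → Maybe (∀ {x} → InRange x → ⟦ f ⟧ x < ⟦ g ⟧ x)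
      <? f g = do
        f+1≤g ← ≤? (𝟏 ⊞ f) g
        just λ {x} x∈ → ℤ.suc[i]≤j⇒i<j (subst (_≤ ⟦ g ⟧ x) (⟦⊞⟧ 𝟏 f x) (f+1≤g x∈))

      Evaluates : Piecewise → Form → Form → Set
      Evaluates g f r = ∀ {x} → InRange x → eval g (⟦ f ⟧ x) ≡ ⟦ r ⟧ x

      -- A case distinction is resolved only if the whole range of `f` lies on one side of the
      -- bound. This is why the intervals have to be cut at every breakpoint.
      eval? : ∀ g f → Maybe (∃ (Evaluates g f))
      eval? (always g) f = just (g ⊚ f , λ {x} _ → sym (⟦⊚⟧ g f x))
      eval? (g below b else h) f = small <∣> large
        where
        small = do
          f<b ← <? f (b ⊚ f)
          just (g ⊚ f , λ {x} x∈ → trans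
            (cong (if_then ⟦ g ⟧ (⟦ f ⟧ x) else eval h (⟦ f ⟧ x))
              (dec-true (⟦ f ⟧ x ℤ.<? ⟦ b ⟧ (⟦ f ⟧ x)) (subst (_ <_) (⟦⊚⟧ b f x) (f<b x∈))))
            (sym (⟦⊚⟧ g f x)))
        large = do
          b≤f ← ≤? (b ⊚ f) f
          r , evaluates ← eval? h f
          just (r , λ {x} x∈ → trans
            (cong (if_then ⟦ g ⟧ (⟦ f ⟧ x) else eval h (⟦ f ⟧ x))
              (dec-false (⟦ f ⟧ x ℤ.<? ⟦ b ⟧ (⟦ f ⟧ x)) (ℤ.≤⇒≯ (subst (_≤ _) (⟦⊚⟧ b f x) (b≤f x∈)))))
            (evaluates x∈))

      eval∘eval? : ∀ g h f → Maybe (∃ λ r → ∀ {x} → InRange x → eval h (eval g (⟦ f ⟧ x)) ≡ ⟦ r ⟧ x)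
      eval∘eval? g h f = do
        r , g[f]≡r ← eval? g f
        s , h[r]≡s ← eval? h r
        just (s , λ x∈ → trans (cong (eval h) (g[f]≡r x∈)) (h[r]≡s x∈))

      evalLine? : ∀ (l : Line) f → Maybe (∃ λ fs → ∀ {x} → InRange x →
        map (λ (g , h) → eval h (eval g (⟦ f ⟧ x))) l ≡ map (λ f → ⟦ f ⟧ x) fs)
      evalLine? []            f = just ([] , λ _ → refl)
      evalLine? ((g , h) ∷ l) f = do
        r  , ≡r  ← eval∘eval? g h f
        rs , ≡rs ← evalLine? l f
        just (r ∷ rs , λ x∈ → cong₂ _∷_ (≡r x∈) (≡rs x∈))

      ⟦∑F⟧ : ∀ fs x → ∑ℤ (map (λ f → ⟦ f ⟧ x) fs) ≡ ⟦ ∑F fs ⟧ x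
      ⟦∑F⟧ []       x = refl
      ⟦∑F⟧ (f ∷ fs) x = trans (cong (λ z → ⟦ f ⟧ x + z) (⟦∑F⟧ fs x)) (sym (⟦⊞⟧ f (∑F fs) x))

      ⟦prefixSumsF⟧ : ∀ a fs x →
        prefixSums (⟦ a ⟧ x) (map (λ f → ⟦ f ⟧ x) fs) ≡ map (λ f → ⟦ f ⟧ x) (prefixSumsF a fs)
      ⟦prefixSumsF⟧ a []       x = refl
      ⟦prefixSumsF⟧ a (f ∷ fs) x = cong₂ _∷_ (sym (⟦⊞⟧ a f x))
        (trans (cong (λ z → prefixSums z (map (λ f → ⟦ f ⟧ x) fs)) (sym (⟦⊞⟧ a f x)))
          (⟦prefixSumsF⟧ (a ⊞ f) fs x))

    lineValues : Line → ℤ → List ℤ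
    lineValues l c = map (λ (g , h) → eval h (eval g c)) l

    lineValues-tabulate : ∀ {K} (pos e : Fin K → Piecewise) c →
      lineValues (tabulate λ k → pos k , e k) c ≡ tabulate λ k → eval (e k) (eval (pos k) c)
    lineValues-tabulate pos e c = List.map-tabulate (λ k → pos k , e k) (λ (g , h) → eval h (eval g c))

    lineValues-reverse : ∀ l c → lineValues (reverse l) c ≡ reverse (lineValues l c)
    lineValues-reverse l c = List.reverse-map (λ (g , h) → eval h (eval g c)) l

    module Modulo (v : ℕ) (vF : Form) (⟦vF⟧ : ∀ x → ⟦ vF ⟧ x ≡ + v) where

      module _ (last : Form) where
        open Ranged last

        ⟦multiple⟧ : ∀ q x → ⟦ form 0ℤ 0ℤ q ⊚ vF ⟧ x ≡ q * + v
        ⟦multiple⟧ q x = trans (⟦⊚⟧ (form 0ℤ 0ℤ q) vF x)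
          (trans (ℤ.+-identityˡ (q * ⟦ vF ⟧ x)) (cong (λ z → q * z) (⟦vF⟧ x)))

        incongruent? : ∀ f g → Maybe (∀ {x} → InRange x → ¬ + v ∣ ⟦ f ⟧ x - ⟦ g ⟧ x)
        -- The intervals between qv and (q + 1)v for these q cover everything strictly between -3v
        -- and 3v apart from multiples of v; those nearest 0 are tried first.
        incongruent? f g = first? separated (- + 1 ∷ + 0 ∷ - + 2 ∷ + 1 ∷ - + 3 ∷ + 2 ∷ [])
          where
          separated : ℤ → Maybe (∀ {x} → InRange x → ¬ + v ∣ ⟦ f ⟧ x - ⟦ g ⟧ x)
          separated q = do
            qv< ← <? (form 0ℤ 0ℤ q ⊚ vF) (f ⊟ g)
            <qv ← <? (f ⊟ g) (form 0ℤ 0ℤ (1ℤ + q) ⊚ vF)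
            just λ {x} x∈ → between⇒∤ q
              (subst₂ _<_ (⟦multiple⟧ q x) (⟦⊟⟧ f g x) (qv< x∈))
              (subst₂ _<_ (⟦⊟⟧ f g x) (⟦multiple⟧ (1ℤ + q) x) (<qv x∈))

        cyclicallySimple? : ∀ l f → Maybe (∀ {x} → InRange x → CyclicallySimple (+ v) (lineValues l (⟦ f ⟧ x)))
        cyclicallySimple? l f = do
          fs , values≡ ← evalLine? l f
          ∑≡0 ← dec⇒maybe (∑F fs ≟F 𝟎)
          prefixes ← allPairs? incongruent? (prefixSumsF 𝟎 fs)
          just λ {x} x∈ → record
            { sum≡0    = trans (cong ∑ℤ (values≡ x∈)) (trans (⟦∑F⟧ fs x) (cong (λ f → ⟦ f ⟧ x) ∑≡0))
            ; prefixes = subst (AllPairs _) (sym (trans (cong (prefixSums 0ℤ) (values≡ x∈)) (⟦prefixSumsF⟧ 𝟎 fs x)))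
                (AllPairs.map⁺ (AllPairs.map (λ f≢g → f≢g x∈) prefixes))
            }

    ⟦shift⟧ : ∀ f c → ⟦ record f { coeffₓ = 1ℤ } ⟧ (c - ⟦ f ⟧ 0ℤ) ≡ c
    ⟦shift⟧ (form α β γ) c = lemma α β γ (+ p) c
      where
      lemma : ∀ α β γ P c → α + β * P + 1ℤ * (c - (α + β * P + γ * 0ℤ)) ≡ c
      lemma = solve-∀

    module _ {A : Set} (P : ℤ → Set)
      (P? : A → ∀ last f → Maybe (∀ {x} → Ranged.InRange last x → P (⟦ f ⟧ x))) (end : Form) where

      -- (a₀ , b₀) ∷ (a₁ , b₁) ∷ … cuts [b₀ , end) into [b₀ , b₁), [b₁ , b₂), ….
      Segments : Set
      Segments = List (A × Form)

      lowest : Segments → Form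
      lowest []            = end
      lowest ((_ , b) ∷ _) = b

      onSegments? : ∀ bs → Maybe (∀ {c} → ⟦ lowest bs ⟧ 0ℤ ≤ c → c < ⟦ end ⟧ 0ℤ → P c)
      onSegments? []             = just λ end≤c c<end → contradiction end≤c (ℤ.<⇒≱ c<end)
      onSegments? ((a , b) ∷ bs) = do
        -- The points of [b, next) are c = b + x with 0 ≤ x ≤ next - b - 1.
        here  ← P? a (lowest bs ⊟ b ⊟ 𝟏) (record b { coeffₓ = 1ℤ })
        there ← onSegments? bs
        just λ {c} b≤c c<end → helper here there b≤c c<end
        where
        helper : (∀ {x} → Ranged.InRange (lowest bs ⊟ b ⊟ 𝟏) x → P (⟦ record b { coeffₓ = 1ℤ } ⟧ x)) →
          (∀ {c} → ⟦ lowest bs ⟧ 0ℤ ≤ c → c < ⟦ end ⟧ 0ℤ → P c) →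
          ∀ {c} → ⟦ b ⟧ 0ℤ ≤ c → c < ⟦ end ⟧ 0ℤ → P c
        helper here there {c} b≤c c<end with c ℤ.<? ⟦ lowest bs ⟧ 0ℤ
        ... | no  c≮next = there (ℤ.≮⇒≥ c≮next) c<end
        ... | yes c<next = subst P (⟦shift⟧ b c) (here (Ranged.inRange (ℤ.i≤j⇒0≤j-i b≤c) (begin
          c - ⟦ b ⟧ 0ℤ                    ≡⟨ lemma c (⟦ b ⟧ 0ℤ) ⟩
          1ℤ + c - ⟦ b ⟧ 0ℤ - 1ℤ          ≤⟨ ℤ.+-monoˡ-≤ -1ℤ (ℤ.+-monoˡ-≤ (- ⟦ b ⟧ 0ℤ) (ℤ.i<j⇒suc[i]≤j c<next)) ⟩
          ⟦ lowest bs ⟧ 0ℤ - ⟦ b ⟧ 0ℤ - 1ℤ ≡⟨ cong (_- 1ℤ) (⟦⊟⟧ (lowest bs) b 0ℤ) ⟨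
          ⟦ lowest bs ⊟ b ⟧ 0ℤ - 1ℤ        ≡⟨ ⟦⊟⟧ (lowest bs ⊟ b) 𝟏 0ℤ ⟨
          ⟦ lowest bs ⊟ b ⊟ 𝟏 ⟧ 0ℤ        ∎)))
          where
          open ℤ.≤-Reasoning
          lemma : ∀ c b → c - b ≡ 1ℤ + c - b - 1ℤ
          lemma = solve-∀

    record Cell {k} (entry : Fin k → Piecewise) (n : Form) (z : ℤ) : Set where
      field
        index     : Fin k
        position  : ℤ
        0≤        : 0ℤ ≤ position
        <n        : position < ⟦ n ⟧ 0ℤ
        value     : eval (entry index) position ≡ z ⊎ eval (entry index) position ≡ - z

    module _ {k} (entry : Fin k → Piecewise) (n N : Form) where

      Represented : ℤ → Set
      Represented z = ⟦ N ⟧ 0ℤ ∣ z ⊎ Cell entry n z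

      represented? : Witness k → ∀ last f → Maybe (∀ {x} → Ranged.InRange last x → Represented (⟦ f ⟧ x))
      represented? (multiple q) last f = do
        f≡qN ← ≈? f qN
        just λ {x} x∈ → inj₁ (divides q (trans (f≡qN x∈) (⟦qN⟧ x)))
        where
        open Ranged last
        qN : Form
        qN = form 0ℤ 0ℤ q ⊚ atOrigin N
        ⟦qN⟧ : ∀ x → ⟦ qN ⟧ x ≡ q * ⟦ N ⟧ 0ℤ
        ⟦qN⟧ x = trans (⟦⊚⟧ (form 0ℤ 0ℤ q) (atOrigin N) x)
          (trans (ℤ.+-identityˡ _) (cong (λ z → q * z) (⟦atOrigin⟧ N x)))
      represented? (single i c) last f = do
        0≤c ← nonneg? c
        c<n ← <? c (atOrigin n)
        r , e[c]≡r ← eval? (entry i) c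
        r≡±f ← Maybe.map (λ r≡f {x} x∈ → inj₁ (r≡f {x} x∈)) (≈? r f) <∣>
               Maybe.map (λ r≡-f {x} x∈ → inj₂ (trans (r≡-f {x} x∈) (⟦neg⟧ f x))) (≈? r (neg f))
        just λ {x} x∈ → inj₂ record
          { index    = i
          ; position = ⟦ c ⟧ x
          ; 0≤       = 0≤c x∈
          ; <n       = subst (⟦ c ⟧ x <_) (⟦atOrigin⟧ n x) (c<n x∈)
          ; value    = Sum.map (trans (e[c]≡r x∈)) (trans (e[c]≡r x∈)) (r≡±f x∈)
          }
        where open Ranged last
      represented? (alternating w₀ w₁) last f = do
        even ← parity w₀ 0ℤ
        odd  ← parity w₁ 1ℤ
        just λ {x} x∈ → cases even odd x x∈ (x ℤ.%ℕ 2) (x ℤ./ℕ 2) (ℤ.n%ℕd<d x 2)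
          (ℤ.0≤n⇒0≤n/ℕd x 2 (Ranged.InRange.nonneg x∈)) (ℤ.a≡a%ℕn+[a/ℕn]*n x 2)
        where
        open Ranged last
        Parity : ℤ → Set
        Parity r = ∀ {y} → 0ℤ ≤ y → InRange (r + y * + 2) → Represented (⟦ f ⟧ (r + y * + 2))

        cases : Parity 0ℤ → Parity 1ℤ → ∀ x → InRange x → ∀ r y → r ℕ.< 2 → 0ℤ ≤ y → x ≡ + r + y * + 2 →
          Represented (⟦ f ⟧ x)
        cases even odd _ x∈ 0 y _ 0≤y refl = even 0≤y x∈
        cases even odd _ x∈ 1 y _ 0≤y refl = odd 0≤y x∈
        cases even odd _ x∈ (ℕ.suc (ℕ.suc r)) y (ℕ.s≤s (ℕ.s≤s ())) 0≤y x≡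

        parity : Witness k → ∀ r → Maybe (Parity r)
        parity w r = do
          last-r≤ ← ≤? (atOrigin last ⊟ form r 0ℤ 0ℤ) (form 1ℤ 0ℤ (+ 2) ⊚ half)
          rep ← represented? w half (f ⊚ form r 0ℤ (+ 2))
          just λ {y} 0≤y x∈ →
            subst Represented (trans (⟦⊚⟧ f (form r 0ℤ (+ 2)) y) (cong ⟦ f ⟧ (swap r y (+ p))))
              (rep (Ranged.inRange 0≤y (halve y _ (begin
                y * + 2                                      ≡⟨ cancel r (y * + 2) ⟩
                r + y * + 2 - r                              ≤⟨ ℤ.+-monoˡ-≤ (- r) (InRange.≤last x∈) ⟩
                ⟦ last ⟧ 0ℤ - r                              ≡⟨ cong (λ z → z - r) (⟦atOrigin⟧ last (r + y * + 2)) ⟨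
                ⟦ atOrigin last ⟧ (r + y * + 2) - r          ≡⟨ cong (λ z → ⟦ atOrigin last ⟧ (r + y * + 2) - z) (constant r) ⟩
                ⟦ atOrigin last ⟧ (r + y * + 2) - ⟦ form r 0ℤ 0ℤ ⟧ (r + y * + 2) ≡⟨ ⟦⊟⟧ (atOrigin last) (form r 0ℤ 0ℤ) (r + y * + 2) ⟨
                ⟦ atOrigin last ⊟ form r 0ℤ 0ℤ ⟧ (r + y * + 2)                   ≤⟨ last-r≤ x∈ ⟩
                ⟦ form 1ℤ 0ℤ (+ 2) ⊚ half ⟧ (r + y * + 2)    ≡⟨ ⟦⊚⟧ (form 1ℤ 0ℤ (+ 2)) half (r + y * + 2) ⟩
                1ℤ + + 2 * ⟦ half ⟧ 0ℤ                       ∎))))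
          where
          open ℤ.≤-Reasoning
          half : Form
          -- Halving each coefficient may fall short of half the value. `last-r≤` checks that twice
          -- the result misses last - r by at most 1, a loss that an integer y absorbs.
          half = form ((Form.const last - r) ℤ./ℕ 2) (Form.coeffₚ last ℤ./ℕ 2) 0ℤ
          swap : ∀ r y P → r + 0ℤ * P + + 2 * y ≡ r + y * + 2
          swap = solve-∀
          cancel : ∀ r z → z ≡ r + z - r
          cancel = solve-∀
          constant : ∀ r → r ≡ r + 0ℤ + 0ℤ
          constant = solve-∀
          halve : ∀ y l → y * + 2 ≤ 1ℤ + + 2 * l → y ≤ l
          halve y l 2y≤ = ℤ.≮⇒≥ λ l<y → ℤ.<-irrefl refl (ℤ.<-≤-trans (ℤ.≤-<-trans 2y≤ (1+2l< l)) (ℤ.*-monoʳ-≤-nonNeg (+ 2) (ℤ.i<j⇒suc[i]≤j l<y)))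
            where
            1+2l< : ∀ l → 1ℤ + + 2 * l < (1ℤ + l) * + 2
            1+2l< l = subst (1ℤ + + 2 * l <_) (double l) (ℤ.suc[i]≤j⇒i<j ℤ.≤-refl)
              where
              double : ∀ l → 1ℤ + (1ℤ + + 2 * l) ≡ (1ℤ + l) * + 2
              double = solve-∀

    positive-neg : ∀ {z} → 1ℤ ≤ z → ¬ 1ℤ ≤ - z
    positive-neg {+ ℕ.suc _} _ ()
    positive-neg {+ ℕ.zero}  _ (+≤+ ())
    positive-neg { -[1+ _ ]} () _

    OwnSign : Piecewise → ℤ → Set
    OwnSign s z = 1ℤ ≤ z × eval s z ≡ 1ℤ ⊎ 1ℤ ≤ - z × eval s (- z) ≡ -1ℤ

    -- `OwnSign` reads `s` at the absolute value only, so z and -z would demand opposite values of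
    -- `s` at the same argument.
    ownSign-neg : ∀ s {z} → OwnSign s z → ¬ OwnSign s (- z)
    ownSign-neg s {z} (inj₁ (1≤z , _)) (inj₁ (1≤-z , _)) = positive-neg 1≤z 1≤-z
    ownSign-neg s {z} (inj₁ (_ , s≡1)) (inj₂ (_ , s≡-1)) =
      contradiction (trans (sym s≡1) (trans (cong (eval s) (sym (ℤ.neg-involutive z))) s≡-1)) λ ()
    ownSign-neg s {z} (inj₂ (_ , s≡-1)) (inj₁ (_ , s≡1)) = contradiction (trans (sym s≡1) s≡-1) λ ()
    ownSign-neg s {z} (inj₂ (1≤-z , _)) (inj₂ (1≤z , _)) = positive-neg 1≤-z 1≤z

    -- The bounds make z the representative that `toℤ` returns for its class, so integer and modular
    -- statements about entries agree.
    record Admissible (s : Piecewise) (half z : ℤ) : Set where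
      field
        ownSign : OwnSign s z
        ≤half   : z ≤ half
        -half≤  : - half ≤ z

    admissible? : ∀ s half e last f → Maybe (∀ {x} → Ranged.InRange last x → Admissible s (⟦ half ⟧ 0ℤ) (eval e (⟦ f ⟧ x)))
    admissible? s half e last f = do
      r , e[f]≡r ← eval? e f
      own ← positive r <∣> negative r
      r≤half ← ≤? r (atOrigin half)
      -half≤r ← ≤? (neg (atOrigin half)) r
      just λ {x} x∈ → subst (Admissible s _) (sym (e[f]≡r x∈)) record
        { ownSign = own x∈
        ; ≤half   = subst (⟦ r ⟧ x ≤_) (⟦atOrigin⟧ half x) (r≤half x∈)
        ; -half≤  = subst (_≤ ⟦ r ⟧ x) (trans (⟦neg⟧ (atOrigin half) x) (cong -_ (⟦atOrigin⟧ half x))) (-half≤r x∈)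
        }
      where
      open Ranged last
      positive negative : ∀ r → Maybe (∀ {x} → InRange x → OwnSign s (⟦ r ⟧ x))
      positive r = do
        1≤r ← ≤? 𝟏 r
        σ , s[r]≡σ ← eval? s r
        σ≡1 ← dec⇒maybe (σ ≟F 𝟏)
        just λ {x} x∈ → inj₁ (1≤r x∈ , trans (s[r]≡σ x∈) (cong (λ f → ⟦ f ⟧ x) σ≡1))
      negative r = do
        1≤-r ← ≤? 𝟏 (neg r)
        σ , s[-r]≡σ ← eval? s (neg r)
        σ≡-1 ← dec⇒maybe (σ ≟F neg 𝟏)
        just λ {x} x∈ → inj₂
          ( subst (1ℤ ≤_) (⟦neg⟧ r x) (1≤-r x∈)
          , trans (cong (eval s) (sym (⟦neg⟧ r x))) (trans (s[-r]≡σ x∈) (cong (λ f → ⟦ f ⟧ x) σ≡-1)))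

    allRanged? : ∀ {A : Set} {P : A → ℤ → Set} {last} →
      (∀ a → Maybe (∀ {x} → Ranged.InRange last x → P a x)) →
      ∀ as → Maybe (∀ {x} → Ranged.InRange last x → All (λ a → P a x) as)
    allRanged? P? as = do
      Pas ← all? P? as
      just λ x∈ → All.map (λ Pa → Pa x∈) Pas

-- From integer lines to residues: sums, signed representatives, rotations

module Residues where

  open AffineForms using (prefixSums; CyclicallySimple; between⇒∤)
  open import Data.Nat.Base as ℕ using (ℕ; zero; suc; NonZero)
  import Data.Nat.Properties as ℕ
  import Data.Nat.DivMod as ℕ
  import Data.Nat.Divisibility as ℕ
  open import Data.Integer.Base using (ℤ; +_; -_; _+_; _-_; _*_; _≤_; _<_; 0ℤ; 1ℤ; -1ℤ; +≤+; +<+)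
  import Data.Integer.Properties as ℤ
  import Data.Integer.DivMod as ℤ
  open import Data.Integer.Divisibility.Signed using (_∣_; divides; ∣m∣n⇒∣m+n; ∣m∣n⇒∣m-n; ∣m⇒∣-m; ∣-refl)
  open import Data.Integer.Tactic.RingSolver using (solve-∀)
  open import Data.Fin.Base using (Fin; zero; suc; toℕ; fromℕ<)
  open import Data.Fin.Properties using (toℕ-fromℕ<; toℕ<n; toℕ-injective)
  open import Data.List.Base using (List; []; _∷_; map; _++_; take; length)
  import Data.List.Properties as List
  open import Data.List.Relation.Unary.All using (All; []; _∷_)
  open import Data.List.Relation.Unary.AllPairs as AllPairs using (AllPairs; []; _∷_)
  import Data.List.Relation.Unary.AllPairs.Properties as AllPairs
  open import Data.Product.Base using (_×_; _,_)
  open import Relation.Binary.Definitions using (tri<; tri≈; tri>)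
  open AssociationLists using (++-comm⁺)
  open import Function.Base using (_∘_)
  open import Relation.Binary.PropositionalEquality
  open import Relation.Nullary using (¬_; yes; no; contradiction)

  ∣-small⇒≡0 : ∀ {m z} → + m ∣ z → - + m < z → z < + m → z ≡ 0ℤ
  ∣-small⇒≡0 {m} {z} m∣z -m<z z<m with ℤ.<-cmp z 0ℤ
  ... | tri≈ _ z≡0 _ = z≡0
  ... | tri< z<0 _ _ = contradiction m∣z (between⇒∤ -1ℤ (subst (_< z) (sym (ℤ.-1*i≡-i (+ m))) -m<z) z<0)
  ... | tri> _ _ 0<z = contradiction m∣z (between⇒∤ 0ℤ 0<z (subst (z <_) (sym (ℤ.*-identityˡ (+ m))) z<m))

  module _ {m : ℕ} where

    infix 4 _≈_
    -- As a relation it follows each operation on classes by the same operation on integers, with no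
    -- need to normalise representatives.
    _≈_ : Fin m → ℤ → Set
    x ≈ z = + m ∣ + toℕ x - z

    ≈-unique : ∀ {x y z} → x ≈ z → y ≈ z → x ≡ y
    ≈-unique {x} {y} {z} x≈z y≈z = toℕ-injective (ℤ.+-injective (ℤ.i-j≡0⇒i≡j (+ toℕ x) (+ toℕ y)
      (∣-small⇒≡0 (subst (+ m ∣_) (lemma (+ toℕ x) (+ toℕ y) z) (∣m∣n⇒∣m-n x≈z y≈z)) lower upper)))
      where
      lemma : ∀ x y z → x - z - (y - z) ≡ x - y
      lemma = solve-∀
      upper : + toℕ x - + toℕ y < + m
      upper = ℤ.≤-<-trans (ℤ.i-j≤i (+ toℕ x) (+ toℕ y)) (+<+ (toℕ<n x))
      lower : - + m < + toℕ x - + toℕ y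
      lower = ℤ.<-≤-trans (ℤ.neg-mono-< (+<+ (toℕ<n y))) (ℤ.i≤j+i (- + toℕ y) (+ toℕ x))

    ≈-functional : ∀ {x z z′} → x ≈ z → x ≈ z′ → + m ∣ z - z′
    ≈-functional {x} {z} {z′} x≈z x≈z′ = subst (+ m ∣_) (lemma (+ toℕ x) z z′) (∣m∣n⇒∣m-n x≈z′ x≈z)
      where
      lemma : ∀ x z z′ → x - z′ - (x - z) ≡ z - z′
      lemma = solve-∀

  module _ {m : ℕ} .{{_ : NonZero m}} where

    ∣%- : ∀ a → + m ∣ + (a ℕ.% m) - + a
    ∣%- a = divides (- + (a ℕ./ m)) (begin
      + (a ℕ.% m) - + a                                     ≡⟨ cong (λ z → + (a ℕ.% m) - + z) (ℕ.m≡m%n+[m/n]*n a m) ⟩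
      + (a ℕ.% m) - + (a ℕ.% m ℕ.+ a ℕ./ m ℕ.* m)           ≡⟨ cong (λ z → + (a ℕ.% m) - z) (trans (ℤ.pos-+ (a ℕ.% m) _) (cong (λ q → + (a ℕ.% m) + q) (ℤ.pos-* (a ℕ./ m) m))) ⟩
      + (a ℕ.% m) - (+ (a ℕ.% m) + + (a ℕ./ m) * + m)       ≡⟨ lemma (+ (a ℕ.% m)) (+ (a ℕ./ m)) (+ m) ⟩
      - + (a ℕ./ m) * + m                                   ∎)
      where
      open ≡-Reasoning
      lemma : ∀ r q m → r - (r + q * m) ≡ - q * m
      lemma = solve-∀

    mod-≈ : ∀ a → (a ℕ.mod m) ≈ + a
    mod-≈ a = subst (λ r → + m ∣ + r - + a) (sym (toℕ-fromℕ< (ℕ.m%n<n a m))) (∣%- a)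

    ι : ℤ → Fin m
    ι z = fromℕ< (ℤ.n%ℕd<d z m)

    ι-≈ : ∀ z → ι z ≈ z
    ι-≈ z = divides (- (z ℤ./ℕ m)) (begin
      + toℕ (ι z) - z                                                ≡⟨ cong (λ r → + r - z) (toℕ-fromℕ< (ℤ.n%ℕd<d z m)) ⟩
      + (z ℤ.%ℕ m) - z                                               ≡⟨ cong (λ w → + (z ℤ.%ℕ m) - w) (ℤ.a≡a%ℕn+[a/ℕn]*n z m) ⟩
      + (z ℤ.%ℕ m) - (+ (z ℤ.%ℕ m) + (z ℤ./ℕ m) * + m)               ≡⟨ lemma (+ (z ℤ.%ℕ m)) (z ℤ./ℕ m) (+ m) ⟩
      - (z ℤ./ℕ m) * + m                                             ∎)
      where
      open ≡-Reasoning
      lemma : ∀ r q m → r - (r + q * m) ≡ - q * m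
      lemma = solve-∀

    𝟘-≈ : 𝟘 ≈ 0ℤ
    𝟘-≈ = mod-≈ 0

    ⊕-≈ : ∀ {x y : Fin m} {z w} → x ≈ z → y ≈ w → x ⊕ y ≈ z + w
    ⊕-≈ {x} {y} {z} {w} x≈z y≈w =
      subst (+ m ∣_) (trans (cong (λ s → + toℕ (x ⊕ y) - s + (+ toℕ x - z + (+ toℕ y - w))) (ℤ.pos-+ (toℕ x) (toℕ y)))
        (lemma (+ toℕ (x ⊕ y)) (+ toℕ x) (+ toℕ y) z w))
        (∣m∣n⇒∣m+n (mod-≈ (toℕ x ℕ.+ toℕ y)) (∣m∣n⇒∣m+n x≈z y≈w))
      where
      lemma : ∀ s x y z w → s - (x + y) + (x - z + (y - w)) ≡ s - (z + w)
      lemma = solve-∀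

    ⊖-≈ : ∀ {x : Fin m} {z} → x ≈ z → ⊖ x ≈ - z
    ⊖-≈ {x} {z} x≈z =
      subst (+ m ∣_) (trans (cong (λ s → + toℕ (⊖ x) - s + + m - (+ toℕ x - z)) ∸≡-) (lemma (+ toℕ (⊖ x)) (+ m) (+ toℕ x) z))
        (∣m∣n⇒∣m-n (∣m∣n⇒∣m+n (mod-≈ (m ℕ.∸ toℕ x)) (∣-refl {+ m})) x≈z)
      where
      ∸≡- : + (m ℕ.∸ toℕ x) ≡ + m - + toℕ x
      ∸≡- = trans (sym (ℤ.⊖-≥ (ℕ.<⇒≤ (toℕ<n x)))) (sym (ℤ.m-n≡m⊖n m (toℕ x)))
      lemma : ∀ s m x z → s - (m - x) + m - (x - z) ≡ s - - z
      lemma = solve-∀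

    ∑-≈ : ∀ zs → ∑ (map ι zs) ≈ ∑ℤ zs
    ∑-≈ []       = 𝟘-≈
    ∑-≈ (z ∷ zs) = ⊕-≈ {ι z} {∑ (map ι zs)} {z} {∑ℤ zs} (ι-≈ z) (∑-≈ zs)

    toℤ-≈ : ∀ (x : Fin m) → x ≈ toℤ x
    toℤ-≈ x with toℕ x ℕ.≤? m ℕ./ 2
    ... | yes _ = divides 0ℤ (ℤ.+-inverseʳ (+ toℕ x))
    ... | no  _ = divides 1ℤ (lemma (+ toℕ x) (+ m))
      where
      lemma : ∀ x m → x - (x - m) ≡ 1ℤ * m
      lemma = solve-∀

    module _ {h} (m≡1+2h : m ≡ 1 ℕ.+ h ℕ.* 2) where

      m/2≡h : m ℕ./ 2 ≡ h
      m/2≡h = trans (cong (ℕ._/ 2) m≡1+2h)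
        (trans (ℕ.+-distrib-/-∣ʳ 1 (ℕ.n∣m*n h {2})) (ℕ.m*n/n≡m h 2))

      +m≡ : + m ≡ 1ℤ + + h + + h
      +m≡ = trans (cong +_ m≡1+2h) (cong (λ k → + suc k) (trans (ℕ.*-comm h 2) (cong (h ℕ.+_) (ℕ.+-identityʳ h))))

      toℤ-bounds : ∀ (x : Fin m) → - + h ≤ toℤ x × toℤ x ≤ + h
      toℤ-bounds x with toℕ x ℕ.≤? m ℕ./ 2
      ... | yes x≤m/2 = ℤ.≤-trans ℤ.neg-≤-pos (+≤+ ℕ.z≤n) , +≤+ (ℕ.≤-trans x≤m/2 (ℕ.≤-reflexive m/2≡h))
      ... | no  x≰m/2 =
        subst (_≤ + toℕ x - + m) (trans (cong (λ m → 1ℤ + + h - m) +m≡) (lemma (+ h)))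
          (ℤ.+-monoˡ-≤ (- + m) (+≤+ (ℕ.≤-trans (ℕ.s≤s (ℕ.≤-reflexive (sym m/2≡h))) (ℕ.≰⇒> x≰m/2)))) ,
        ℤ.≤-trans (ℤ.i≤j⇒i-j≤0 (+≤+ (ℕ.<⇒≤ (toℕ<n x)))) (+≤+ ℕ.z≤n)
        where
        lemma : ∀ h → 1ℤ + h - (1ℤ + h + h) ≡ - h
        lemma = solve-∀

      -- Both integers lie in an interval of length 2h = m - 1, too short for a nonzero multiple of
      -- m as their difference.
      ≈-bounded : ∀ {x : Fin m} {z w} → x ≈ z → x ≈ w →
        - + h ≤ z → z ≤ + h → - + h ≤ w → w ≤ + h → z ≡ w
      ≈-bounded {x} {z} {w} x≈z x≈w -h≤z z≤h -h≤w w≤h =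
        ℤ.i-j≡0⇒i≡j z w (∣-small⇒≡0 (≈-functional {x = x} {z} {w} x≈z x≈w) lower upper)
        where
        upper : z - w < + m
        upper = subst (z - w <_) (trans (lemma (+ h)) (sym +m≡))
          (ℤ.≤-<-trans (ℤ.+-mono-≤ z≤h (ℤ.neg-mono-≤ -h≤w)) (ℤ.suc[i]≤j⇒i<j ℤ.≤-refl))
          where
          lemma : ∀ h → 1ℤ + (h - - h) ≡ 1ℤ + h + h
          lemma = solve-∀
        lower : - + m < z - w
        lower = ℤ.<-≤-trans (subst (_< - + h - + h) (trans (lemma (+ h)) (cong -_ (sym +m≡))) (ℤ.suc[i]≤j⇒i<j (ℤ.≤-reflexive (lemma₂ (+ h)))))
          (ℤ.+-mono-≤ -h≤z (ℤ.neg-mono-≤ w≤h))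
          where
          lemma : ∀ h → -1ℤ + (- h - h) ≡ - (1ℤ + h + h)
          lemma = solve-∀
          lemma₂ : ∀ h → 1ℤ + (-1ℤ + (- h - h)) ≡ - h - h
          lemma₂ = solve-∀

      toℤ-ι : ∀ {z} → - + h ≤ z → z ≤ + h → toℤ (ι z) ≡ z
      toℤ-ι {z} -h≤z z≤h with -h≤ , ≤h ← toℤ-bounds (ι z) = ≈-bounded {ι z} (toℤ-≈ (ι z)) (ι-≈ z) -h≤ ≤h -h≤z z≤h

  prefixSums-++ : ∀ a xs ys → prefixSums a (xs ++ ys) ≡ prefixSums a xs ++ prefixSums (a + ∑ℤ xs) ys
  prefixSums-++ a []       ys = cong (λ a → prefixSums a ys) (sym (ℤ.+-identityʳ a))
  prefixSums-++ a (x ∷ xs) ys = cong (λ ss → a + x ∷ ss) (trans (prefixSums-++ (a + x) xs ys)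
    (cong (λ b → prefixSums (a + x) xs ++ prefixSums b ys) (ℤ.+-assoc a x (∑ℤ xs))))

  prefixSums-shift : ∀ a b xs → prefixSums (a + b) xs ≡ map (λ s → a + s) (prefixSums b xs)
  prefixSums-shift a b []       = refl
  prefixSums-shift a b (x ∷ xs) = cong₂ _∷_ (ℤ.+-assoc a b x)
    (trans (cong (λ c → prefixSums c xs) (ℤ.+-assoc a b x)) (prefixSums-shift a (b + x) xs))

  ∑ℤ-++ : ∀ xs ys → ∑ℤ (xs ++ ys) ≡ ∑ℤ xs + ∑ℤ ys
  ∑ℤ-++ []       ys = sym (ℤ.+-identityˡ (∑ℤ ys))
  ∑ℤ-++ (x ∷ xs) ys = trans (cong (λ s → x + s) (∑ℤ-++ xs ys)) (sym (ℤ.+-assoc x (∑ℤ xs) (∑ℤ ys)))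

  -- Because the total is 0, adding `∑ℤ ys` to the partial sums of `xs ++ ys` gives those of
  -- `ys ++ xs` in rotated order. A translation keeps all differences, and incongruence is
  -- symmetric.
  rotate : ∀ {V} xs ys → CyclicallySimple V (xs ++ ys) → CyclicallySimple V (ys ++ xs)
  rotate {V} xs ys record { sum≡0 = sum≡0 ; prefixes = prefixes } = record
    { sum≡0    = trans (∑ℤ-++ ys xs) (trans (ℤ.+-comm (∑ℤ ys) (∑ℤ xs)) total)
    ; prefixes = subst (AllPairs _) (sym (prefixSums-++ 0ℤ ys xs)) rotated
    }
    where
    total : ∑ℤ xs + ∑ℤ ys ≡ 0ℤ
    total = trans (sym (∑ℤ-++ xs ys)) sum≡0

    translate : ∀ {ss} t → AllPairs (λ a b → ¬ V ∣ a - b) ss → AllPairs (λ a b → ¬ V ∣ a - b) (map (λ s → t + s) ss)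
    translate t = AllPairs.map⁺ ∘ AllPairs.map λ {a} {b} ∤ → ∤ ∘ subst (V ∣_) (lemma t a b)
      where
      lemma : ∀ t a b → t + a - (t + b) ≡ a - b
      lemma = solve-∀

    back : ∀ ss → map (λ s → ∑ℤ ys + s) (map (λ s → ∑ℤ xs + s) ss) ≡ ss
    back ss = trans (sym (List.map-∘ ss)) (trans (List.map-cong (λ s → begin
      ∑ℤ ys + (∑ℤ xs + s) ≡⟨ ℤ.+-assoc (∑ℤ ys) (∑ℤ xs) s ⟨
      ∑ℤ ys + ∑ℤ xs + s   ≡⟨ cong (λ t → t + s) (trans (ℤ.+-comm (∑ℤ ys) (∑ℤ xs)) total) ⟩
      0ℤ + s              ≡⟨ ℤ.+-identityˡ s ⟩
      s                   ∎) ss) (List.map-id ss))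
      where open ≡-Reasoning

    from-0 : ∀ t zs → prefixSums (0ℤ + t) zs ≡ map (λ s → t + s) (prefixSums 0ℤ zs)
    from-0 t zs = trans (cong (λ a → prefixSums a zs) (ℤ.+-comm 0ℤ t)) (prefixSums-shift t 0ℤ zs)

    rotated : AllPairs (λ a b → ¬ V ∣ a - b) (prefixSums 0ℤ ys ++ prefixSums (0ℤ + ∑ℤ ys) xs)
    rotated = subst (AllPairs _)
      (begin
        map (λ s → ∑ℤ ys + s) (prefixSums (0ℤ + ∑ℤ xs) ys ++ prefixSums 0ℤ xs)
          ≡⟨ List.map-++ (λ s → ∑ℤ ys + s) (prefixSums (0ℤ + ∑ℤ xs) ys) (prefixSums 0ℤ xs) ⟩
        map (λ s → ∑ℤ ys + s) (prefixSums (0ℤ + ∑ℤ xs) ys) ++ map (λ s → ∑ℤ ys + s) (prefixSums 0ℤ xs)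
          ≡⟨ cong₂ _++_ (trans (cong (map (λ s → ∑ℤ ys + s)) (from-0 (∑ℤ xs) ys)) (back (prefixSums 0ℤ ys))) (sym (from-0 (∑ℤ ys) xs)) ⟩
        prefixSums 0ℤ ys ++ prefixSums (0ℤ + ∑ℤ ys) xs ∎)
      (translate (∑ℤ ys) (++-comm⁺ (λ {a} {b} ∤ → ∤ ∘ subst (V ∣_) (lemma b a) ∘ ∣m⇒∣-m) (prefixSums 0ℤ xs)
        (subst (AllPairs _) (prefixSums-++ 0ℤ xs ys) prefixes)))
      where
      open ≡-Reasoning
      lemma : ∀ a b → - (a - b) ≡ b - a
      lemma = solve-∀

  module _ {m : ℕ} .{{_ : NonZero m}} where

    private
      take-∈ : ∀ {P : ℤ → Set} a zs → All P (prefixSums a zs) →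
        ∀ (j : Fin (length (map (ι {m}) zs))) → P (a + ∑ℤ (take (suc (toℕ j)) zs))
      take-∈ {P} a (z ∷ zs) (pz ∷ _)   zero    = subst P (cong (λ z → a + z) (sym (ℤ.+-identityʳ z))) pz
      take-∈ {P} a (z ∷ zs) (_ ∷ pzs) (suc j) = subst P (ℤ.+-assoc a z _) (take-∈ (a + z) zs pzs j)

      prefix-injective : ∀ a zs → AllPairs (λ b c → ¬ + m ∣ b - c) (prefixSums a zs) →
        ∀ (i j : Fin (length (map (ι {m}) zs))) →
        + m ∣ a + ∑ℤ (take (suc (toℕ i)) zs) - (a + ∑ℤ (take (suc (toℕ j)) zs)) → i ≡ j
      prefix-injective a (z ∷ zs) _ zero zero _ = refl
      prefix-injective a (z ∷ zs) (∤ ∷ _) zero (suc j) m∣ =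
        contradiction (subst (+ m ∣_) (cong₂ _-_ (cong (λ z → a + z) (ℤ.+-identityʳ z)) (sym (ℤ.+-assoc a z _))) m∣)
          (take-∈ (a + z) zs ∤ j)
      prefix-injective a (z ∷ zs) (∤ ∷ _) (suc i) zero m∣ =
        contradiction (subst (+ m ∣_) (trans (lemma (a + (z + ∑ℤ (take (suc (toℕ i)) zs))) (a + (z + 0ℤ))) (cong₂ _-_ (cong (λ z → a + z) (ℤ.+-identityʳ z)) (sym (ℤ.+-assoc a z _)))) (∣m⇒∣-m m∣))
          (take-∈ (a + z) zs ∤ i)
        where
        lemma : ∀ a b → - (a - b) ≡ b - a
        lemma = solve-∀
      prefix-injective a (z ∷ zs) (_ ∷ ∤s) (suc i) (suc j) m∣ = cong suc (prefix-injective (a + z) zs ∤s i j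
        (subst (+ m ∣_) (cong₂ _-_ (sym (ℤ.+-assoc a z _)) (sym (ℤ.+-assoc a z _))) m∣))

    cyclicallySimple⇒simple : ∀ zs → CyclicallySimple (+ m) zs → Simple (map (ι {m}) zs)
    cyclicallySimple⇒simple zs simple {i} {j} sᵢ≡sⱼ =
      prefix-injective 0ℤ zs (CyclicallySimple.prefixes simple) i j
        (subst (+ m ∣_) (cong₂ _-_ (sym (ℤ.+-identityˡ (prefix i))) (sym (ℤ.+-identityˡ (prefix j))))
          (≈-functional {x = partialSum (map ι zs) i} {prefix i} {prefix j} (prefix-≈ i)
            (subst (_≈ prefix j) (sym sᵢ≡sⱼ) (prefix-≈ j))))
      where
      prefix : Fin (length (map (ι {m}) zs)) → ℤ
      prefix i = ∑ℤ (take (suc (toℕ i)) zs)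
      prefix-≈ : ∀ i → partialSum (map ι zs) i ≈ prefix i
      prefix-≈ i = subst (λ xs → ∑ xs ≈ prefix i) (sym (List.take-map (suc (toℕ i)) zs)) (∑-≈ (take (suc (toℕ i)) zs))

-- The array in explicit form and the tests run on it

module Table where

  open AffineForms
  open import Data.List.Relation.Unary.All using (All)
  open import Data.Unit.Base using (⊤; tt)
  open import Data.Nat.Base using (ℕ)
  open import Data.Integer.Base using (ℤ; +_; _+_; _≤_; _<_; 0ℤ; 1ℤ)
  open import Data.Fin.Base using (Fin; inject₁)
  open import Data.Fin.Patterns
  open import Data.List.Base using (List; []; _∷_; map; reverse; tabulate)
  open import Data.Maybe.Base using (from-just)
  open import Data.Product.Base using (_×_; _,_; uncurry)
  open import Relation.Binary.PropositionalEquality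

  infix 9 _⊹_·p
  _⊹_·p : ℕ → ℕ → Form
  α ⊹ β ·p = form (+ α) (+ β) 0ℤ

  2X : Form
  2X = X ⊞ X

  -- (α , β) stands for α + β p.  The first nine bounds are the filled diagonals
  -- 0 , … , 4 and h , … , h + 3; the last one is n.
  boundCoeffs : Fin 10 → ℕ × ℕ
  boundCoeffs 0F = 0 , 0
  boundCoeffs 1F = 1 , 0
  boundCoeffs 2F = 2 , 0
  boundCoeffs 3F = 3 , 0
  boundCoeffs 4F = 4 , 0
  boundCoeffs 5F = 6 , 2
  boundCoeffs 6F = 7 , 2
  boundCoeffs 7F = 8 , 2
  boundCoeffs 8F = 9 , 2
  boundCoeffs 9F = 11 , 4

  offsetF : Fin 9 → Form
  offsetF k = uncurry _⊹_·p (boundCoeffs (inject₁ k))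

  nF NF vF halfF : Form
  nF    = 11 ⊹ 4 ·p
  NF    = 23 ⊹ 8 ·p
  vF    = 207 ⊹ 72 ·p
  halfF = 103 ⊹ 36 ·p

  -- The triples are 0F, 5F, 1F, then 3F, 8F, 4F, and 6F, 2F, 7F; the last one is built on s.
  entry : Fin 9 → Piecewise
  entry 0F = 17 ⊹ 6 ·p ⊞ X below 6 ⊹ 2 ·p else always (6 ⊹ 2 ·p ⊞ X)
  entry 1F = always (neg (68 ⊹ 24 ·p) ⊞ X)
  entry 2F = 6 ⊹ 2 ·p ⊞ 2X below 3 ⊹ 1 ·p else
             5 ⊹ 2 ·p ⊟ 2X below 5 ⊹ 2 ·p else
             -- The pieces of slope ±2 miss the odd absolute values n and 5 + 2p. The single columns
             -- 5 + 2p and 8 + 3p, where s(c) and s(c - h) have opposite slopes, supply them.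
             neg (11 ⊹ 4 ·p) below 6 ⊹ 2 ·p else
             neg (5 ⊹ 2 ·p) ⊞ 2X below 8 ⊹ 3 ·p else
             5 ⊹ 2 ·p below 9 ⊹ 3 ·p else
             always (16 ⊹ 6 ·p ⊟ 2X)
  entry 3F = 52 ⊹ 18 ·p ⊞ X below 6 ⊹ 2 ·p else always (41 ⊹ 14 ·p ⊞ X)
  entry 4F = always (35 ⊹ 12 ·p ⊞ X)
  entry 5F = 34 ⊹ 12 ·p ⊟ 2X below 6 ⊹ 2 ·p else always (45 ⊹ 16 ·p ⊟ 2X)
  entry 6F = neg (89 ⊹ 31 ·p) ⊟ X below 3 ⊹ 1 ·p else
             neg (89 ⊹ 31 ·p) ⊞ X below 6 ⊹ 2 ·p else
             neg (95 ⊹ 33 ·p) ⊟ X below 9 ⊹ 3 ·p else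
             always (neg (106 ⊹ 37 ·p) ⊞ X)
  entry 7F = 83 ⊹ 29 ·p ⊟ X below 3 ⊹ 1 ·p else
             84 ⊹ 29 ·p ⊞ X below 5 ⊹ 2 ·p else
             100 ⊹ 35 ·p ⊟ X below 8 ⊹ 3 ·p else
             always (90 ⊹ 31 ·p ⊞ X)
  entry 8F = neg (70 ⊹ 24 ·p) ⊟ 2X below 6 ⊹ 2 ·p else always (neg (59 ⊹ 20 ·p) ⊟ 2X)

  columnLine : Line
  columnLine = tabulate λ k → always X , entry k

  -- The column in which row X meets diagonal o.
  rotateBack : Form → Piecewise
  rotateBack o = X ⊟ o ⊞ nF below o else always (X ⊟ o)

  rowLine : Line
  rowLine = reverse (tabulate λ k → rotateBack (offsetF k) , entry k)

  -- For columns, 0 and the breakpoints of all entries. For rows, every filled diagonal o and every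
  -- o + b modulo n, with b a breakpoint of the entry on o: there the column index wraps or crosses
  -- b.
  columnBreaks rowBreaks : List (⊤ × Form)
  columnBreaks = map (tt ,_)
    (0 ⊹ 0 ·p ∷ 3 ⊹ 1 ·p ∷ 5 ⊹ 2 ·p ∷ 6 ⊹ 2 ·p ∷ 8 ⊹ 3 ·p ∷ 9 ⊹ 3 ·p ∷ [])
  rowBreaks = map (tt ,_)
    (0 ⊹ 0 ·p ∷ 1 ⊹ 0 ·p ∷ 2 ⊹ 0 ·p ∷ 3 ⊹ 0 ·p ∷ 4 ⊹ 0 ·p ∷ 5 ⊹ 1 ·p ∷
     6 ⊹ 2 ·p ∷ 7 ⊹ 2 ·p ∷ 8 ⊹ 2 ·p ∷ 9 ⊹ 2 ·p ∷ 10 ⊹ 3 ·p ∷ 11 ⊹ 3 ·p ∷ [])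

  -- The sign with which each absolute value occurs: it rules out that both x and - x appear.
  signF : Piecewise
  signF = neg 𝟏 below 5 ⊹ 2 ·p else
          𝟏     below 11 ⊹ 4 ·p else
          neg 𝟏 below 12 ⊹ 4 ·p else
          𝟏     below 58 ⊹ 20 ·p else
          neg 𝟏 below 81 ⊹ 28 ·p else
          𝟏     below 84 ⊹ 29 ·p else
          neg 𝟏 below 87 ⊹ 30 ·p else
          𝟏     below 89 ⊹ 31 ·p else
          neg 𝟏 below 93 ⊹ 32 ·p else
          𝟏     below 96 ⊹ 33 ·p else
          neg 𝟏 below 98 ⊹ 34 ·p else
          𝟏     below 101 ⊹ 35 ·p else
          always (neg 𝟏)

  -- Up to 4N + n there are nine blocks of n integers, two after each of 0, N, 2N, 3N and one after
  -- 4N. They lie on `2F`, `0F`; `5F`, `4F`; `3F`, `1F`; `8F`; the last two, 4N ± 1, ..., 4N ± n,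
  -- are shared by `6F` and `7F`. `5F`, `8F` and most of `2F` move in steps of 2, so neighbouring
  -- integers come alternately from two ranges of columns.
  valueTable : List (Witness 9 × Form)
  valueTable =
    (alternating (single 2F (3 ⊹ 1 ·p ⊞ X)) (single 2F (9 ⊹ 3 ·p ⊞ X)) , 1 ⊹ 0 ·p) ∷
    (single 2F (8 ⊹ 3 ·p ⊞ X) , 5 ⊹ 2 ·p) ∷
    (alternating (single 2F X) (single 2F (6 ⊹ 2 ·p ⊞ X)) , 6 ⊹ 2 ·p) ∷
    (single 2F (5 ⊹ 2 ·p ⊞ X) , 11 ⊹ 4 ·p) ∷
    (single 0F (6 ⊹ 2 ·p ⊞ X) , 12 ⊹ 4 ·p) ∷
    (single 0F X , 17 ⊹ 6 ·p) ∷
    (multiple (+ 1) , 23 ⊹ 8 ·p) ∷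
    (alternating (single 5F (5 ⊹ 2 ·p ⊟ X)) (single 5F (10 ⊹ 4 ·p ⊟ X)) , 24 ⊹ 8 ·p) ∷
    (single 4F X , 35 ⊹ 12 ·p) ∷
    (multiple (+ 2) , 46 ⊹ 16 ·p) ∷
    (single 3F (6 ⊹ 2 ·p ⊞ X) , 47 ⊹ 16 ·p) ∷
    (single 3F X , 52 ⊹ 18 ·p) ∷
    (single 1F (10 ⊹ 4 ·p ⊟ X) , 58 ⊹ 20 ·p) ∷
    (multiple (+ 3) , 69 ⊹ 24 ·p) ∷
    (alternating (single 8F X) (single 8F (6 ⊹ 2 ·p ⊞ X)) , 70 ⊹ 24 ·p) ∷
    (single 7F (2 ⊹ 1 ·p ⊟ X) , 81 ⊹ 28 ·p) ∷
    (single 6F (5 ⊹ 2 ·p ⊟ X) , 84 ⊹ 29 ·p) ∷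
    (single 7F (3 ⊹ 1 ·p ⊞ X) , 87 ⊹ 30 ·p) ∷
    (single 6F X , 89 ⊹ 31 ·p) ∷
    (multiple (+ 4) , 92 ⊹ 32 ·p) ∷
    (single 7F (7 ⊹ 3 ·p ⊟ X) , 93 ⊹ 32 ·p) ∷
    (single 6F (10 ⊹ 4 ·p ⊟ X) , 96 ⊹ 33 ·p) ∷
    (single 7F (8 ⊹ 3 ·p ⊞ X) , 98 ⊹ 34 ·p) ∷
    (single 6F (6 ⊹ 2 ·p ⊞ X) , 101 ⊹ 35 ·p) ∷ []

  module _ (p : ℕ) where
    open Semantics p

    -- `from-just` makes type checking run the test. The variable p does not block it: only
    -- coefficients are inspected, and these are closed numerals, so one run serves every p. The
    -- test sees the modulus as `vF`; `v` enters only the resulting proof.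
    columns-cyclicallySimple : ∀ (v : ℕ) (⟦vF⟧ : ∀ x → ⟦ vF ⟧ x ≡ + v) {c} →
      0ℤ ≤ c → c < ⟦ nF ⟧ 0ℤ → CyclicallySimple (+ v) (lineValues columnLine c)
    columns-cyclicallySimple v ⟦vF⟧ = from-just
      (onSegments? (λ c → CyclicallySimple (+ v) (lineValues columnLine c))
        (λ _ last → Modulo.cyclicallySimple? v vF ⟦vF⟧ last columnLine) nF columnBreaks)

    rows-cyclicallySimple : ∀ (v : ℕ) (⟦vF⟧ : ∀ x → ⟦ vF ⟧ x ≡ + v) {r} →
      0ℤ ≤ r → r < ⟦ nF ⟧ 0ℤ → CyclicallySimple (+ v) (lineValues rowLine r)
    rows-cyclicallySimple v ⟦vF⟧ = from-just
      (onSegments? (λ r → CyclicallySimple (+ v) (lineValues rowLine r))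
        (λ _ last → Modulo.cyclicallySimple? v vF ⟦vF⟧ last rowLine) nF rowBreaks)

    values-represented : ∀ {z} → 1ℤ ≤ z → z < ⟦ 104 ⊹ 36 ·p ⟧ 0ℤ → Represented entry nF NF z
    values-represented = from-just
      (onSegments? (Represented entry nF NF) (represented? entry nF NF) (104 ⊹ 36 ·p) valueTable)

    EntriesAdmissible : ℤ → Set
    EntriesAdmissible c = All (λ e → Admissible signF (⟦ halfF ⟧ 0ℤ) (eval e c)) (tabulate entry)

    entries-admissible : ∀ {c} → 0ℤ ≤ c → c < ⟦ nF ⟧ 0ℤ → EntriesAdmissible c
    entries-admissible = from-just (onSegments? EntriesAdmissible
      (λ _ last f → allRanged? (λ e → admissible? signF halfF e last f) (tabulate entry)) nF columnBreaks)

-- Assembly: Heffter conditions, integrality, simplicity and strip width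

module HeffterArray where

  open AffineForms
  open Table
  open AssociationLists
  open Residues
  open MultiplesSubgroup
  open CyclicDiagonalArrays
  open import Data.Bool.Base using (if_then_else_)
  open import Data.Nat.Base as ℕ using (ℕ; suc; z≤n; _≥_)
  import Data.Nat.Properties as ℕ
  import Data.Nat.DivMod as ℕ
  import Data.Nat.Divisibility as ℕ
  import Data.Nat.Tactic.RingSolver as ℕ
  open import Data.Integer.Base using (ℤ; +_; -_; _+_; _-_; _*_; _≤_; _<_; 0ℤ; 1ℤ; +≤+; +<+; ∣_∣)
  import Data.Integer.Properties as ℤ
  open import Data.Integer.Divisibility.Signed as ℤ using (_∣_; divides)
  open import Data.Integer.Tactic.RingSolver using (solve-∀)
  open import Data.Fin.Base as Fin using (Fin; suc; toℕ; fromℕ<; inject₁)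
  open import Data.Fin.Patterns
  open import Data.Fin.Properties as Fin using (toℕ-fromℕ<; toℕ<n)
  open import Data.List.Base using (List; []; _∷_; map; _++_; length; tabulate; reverse)
  import Data.List.Properties as List
  open import Data.List.Relation.Unary.All as All using (All; []; _∷_)
  import Data.List.Relation.Unary.All.Properties as All
  open import Data.List.Relation.Unary.AllPairs using ([]; _∷_)
  open import Data.Maybe.Base as Maybe using (Maybe; just)
  open import Data.Maybe.Relation.Unary.Any using (just)
  open import Data.Maybe.Relation.Unary.All using (just)
  open import Data.Product.Base using (_×_; _,_; proj₁; proj₂; ∃)
  open import Data.Sum.Base as Sum using (_⊎_; inj₁; inj₂)
  open import Function.Base using (_∘_)
  open import Relation.Binary.Definitions using (Tri; tri<; tri≈; tri>)
  open import Relation.Binary.PropositionalEquality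
  open import Relation.Nullary using (¬_; Dec; yes; no; contradiction)
  open import Relation.Nullary.Decidable using (from-yes; _×-dec_; _⊎-dec_; _→-dec_; dec-true; dec-false)

  infix 4 _≺_ _≼_ _≺?_ _≼?_

  -- Comparing coefficients is decidable and gives the inequality between α + βp and α′ + β′p at
  -- every p at once.
  _≺_ _≼_ : ℕ × ℕ → ℕ × ℕ → Set
  (α , β) ≺ (α′ , β′) = α ℕ.< α′ × β ℕ.≤ β′
  (α , β) ≼ (α′ , β′) = α ℕ.≤ α′ × β ℕ.≤ β′

  _≺?_ : ∀ a b → Dec (a ≺ b)
  (α , β) ≺? (α′ , β′) = α ℕ.<? α′ ×-dec β ℕ.≤? β′

  _≼?_ : ∀ a b → Dec (a ≼ b)
  (α , β) ≼? (α′ , β′) = α ℕ.≤? α′ ×-dec β ℕ.≤? β′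

  module Construction (p : ℕ) where
    open Semantics p

    n N half v : ℕ
    n    = 11 ℕ.+ 4 ℕ.* p
    N    = 23 ℕ.+ 8 ℕ.* p
    half = 103 ℕ.+ 36 ℕ.* p
    v    = modulus n 9 9

    open Heffter n 9 9 using (v-nonZero)

    ⟦⊹⟧ : ∀ α β x → ⟦ α ⊹ β ·p ⟧ x ≡ + (α ℕ.+ β ℕ.* p)
    ⟦⊹⟧ α β x = trans (ℤ.+-identityʳ _) (cong (λ z → + α + z) (sym (ℤ.pos-* β p)))

    v≡1+2half : v ≡ 1 ℕ.+ half ℕ.* 2
    v≡1+2half = lemma p
      where
      lemma : ∀ p → 2 ℕ.* (11 ℕ.+ 4 ℕ.* p) ℕ.* 9 ℕ.+ 9 ≡ 1 ℕ.+ (103 ℕ.+ 36 ℕ.* p) ℕ.* 2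
      lemma = ℕ.solve-∀

    v≡9N : v ≡ 9 ℕ.* N
    v≡9N = lemma p
      where
      lemma : ∀ p → 2 ℕ.* (11 ℕ.+ 4 ℕ.* p) ℕ.* 9 ℕ.+ 9 ≡ 9 ℕ.* (23 ℕ.+ 8 ℕ.* p)
      lemma = ℕ.solve-∀

    ⟦vF⟧ : ∀ x → ⟦ vF ⟧ x ≡ + v
    ⟦vF⟧ x = trans (⟦⊹⟧ 207 72 x) (cong +_ (lemma p))
      where
      lemma : ∀ p → 207 ℕ.+ 72 ℕ.* p ≡ 2 ℕ.* (11 ℕ.+ 4 ℕ.* p) ℕ.* 9 ℕ.+ 9
      lemma = ℕ.solve-∀

    at-p : ℕ × ℕ → ℕ
    at-p (α , β) = α ℕ.+ β ℕ.* p

    at-p-mono-< : ∀ {a b} → a ≺ b → at-p a ℕ.< at-p b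
    at-p-mono-< (α< , β≤) = ℕ.+-mono-<-≤ α< (ℕ.*-monoˡ-≤ p β≤)

    at-p-mono-≤ : ∀ {a b} → a ≼ b → at-p a ℕ.≤ at-p b
    at-p-mono-≤ (α≤ , β≤) = ℕ.+-mono-≤ α≤ (ℕ.*-monoˡ-≤ p β≤)

    offset next : Fin 9 → ℕ
    offset k = at-p (boundCoeffs (inject₁ k))
    next k   = at-p (boundCoeffs (suc k))

    offset-mono-< : ∀ {j k} → j Fin.< k → offset j ℕ.< offset k
    offset-mono-< {j} {k} j<k = at-p-mono-< (from-yes increasing? j k j<k)
      where
      increasing? = Fin.all? λ j → Fin.all? λ k →
        j Fin.<? k →-dec boundCoeffs (inject₁ j) ≺? boundCoeffs (inject₁ k)

    offset<n : ∀ k → offset k ℕ.< n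
    offset<n k = at-p-mono-< (from-yes (Fin.all? λ k → boundCoeffs (inject₁ k) ≺? (11 , 4)) k)

    no-offset-between : ∀ k j → offset j ℕ.≤ offset k ⊎ next k ℕ.≤ offset j
    no-offset-between k j = Sum.map at-p-mono-≤ at-p-mono-≤ (from-yes none-between? k j)
      where
      none-between? = Fin.all? λ k → Fin.all? λ j →
        boundCoeffs (inject₁ j) ≼? boundCoeffs (inject₁ k) ⊎-dec boundCoeffs (suc k) ≼? boundCoeffs (inject₁ j)

    value : Fin 9 → ℕ → ℤ
    value k c = eval (entry k) (+ c)

    open Diagonals offset offset-mono-< offset<n value

    A : Heffter.Array n 9 9
    A r c = Maybe.map ι (array r c)

    -- Gathers what is needed of a row or column in a form that survives rotation, so it can be
    -- checked in the order of the diagonals and carried to the natural ordering.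
    IsLine : List ℤ → Set
    IsLine zs = CyclicallySimple (+ v) zs × length zs ≡ 9 × All (λ z → - + half ≤ z × z ≤ + half) zs

    IsLine-rotate : ∀ xs ys → IsLine (xs ++ ys) → IsLine (ys ++ xs)
    IsLine-rotate xs ys (simple , length≡9 , bounded) =
      rotate xs ys simple ,
      trans (List.length-++ ys) (trans (ℕ.+-comm (length ys) (length xs)) (trans (sym (List.length-++ xs)) length≡9)) ,
      All.++⁺ (All.++⁻ʳ xs bounded) (All.++⁻ˡ xs bounded)

    +<⟦nF⟧ : ∀ {c} → c ℕ.< n → + c < ⟦ nF ⟧ 0ℤ
    +<⟦nF⟧ {c} c<n = subst (+ c <_) (sym (⟦⊹⟧ 11 4 0ℤ)) (+<+ c<n)

    admissible-value : ∀ k {c} → c ℕ.< n → Admissible signF (+ half) (value k c)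
    admissible-value k {c} c<n = subst (λ h → Admissible signF h (value k c)) (⟦⊹⟧ 103 36 0ℤ)
      (All.tabulate⁻ {f = entry} (entries-admissible p (+≤+ z≤n) (+<⟦nF⟧ c<n)) k)

    value-bounded : ∀ k {c} → c ℕ.< n → - + half ≤ value k c × value k c ≤ + half
    value-bounded k c<n = Admissible.-half≤ (admissible-value k c<n) , Admissible.≤half (admissible-value k c<n)

    ⟦X⟧ : ∀ x → ⟦ X ⟧ x ≡ x
    ⟦X⟧ x = trans (ℤ.+-identityˡ (1ℤ * x)) (ℤ.*-identityˡ x)

    columnValues≡ : ∀ c → lineValues columnLine (+ c) ≡ tabulate λ k → value k c
    columnValues≡ c = trans (lineValues-tabulate (λ _ → always X) entry (+ c))
      (List.tabulate-cong λ k → cong (eval (entry k)) (⟦X⟧ (+ c)))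

    column-isLine : ∀ c → IsLine (column array c)
    column-isLine c =
      let xs , ys , zs≡ , column≡ = column-rotation c
      in subst IsLine (sym column≡) (IsLine-rotate xs ys (subst IsLine zs≡
        ( subst (CyclicallySimple (+ v)) (columnValues≡ (toℕ c)) (columns-cyclicallySimple p v ⟦vF⟧ (+≤+ z≤n) (+<⟦nF⟧ (toℕ<n c)))
        , List.length-tabulate (λ k → value k (toℕ c))
        , All.tabulate⁺ {f = λ k → value k (toℕ c)} λ k → value-bounded k (toℕ<n c))))

    -- For r < o the number r + (n - o) is already below n; otherwise it exceeds r - o by exactly n.
    eval-rotateBack : ∀ r k → r ℕ.< n → eval (rotateBack (offsetF k)) (+ r) ≡ + columnOf r k
    eval-rotateBack r k r<n = go (offsetF k) (offset<n k) (⟦⊹⟧ (proj₁ (boundCoeffs (inject₁ k))) (proj₂ (boundCoeffs (inject₁ k))))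
      where
      go : ∀ f {o} → o ℕ.< n → (∀ x → ⟦ f ⟧ x ≡ + o) → eval (rotateBack f) (+ r) ≡ + ((r ℕ.+ (n ℕ.∸ o)) ℕ.% n)
      go f {o} o<n ⟦f⟧ with r ℕ.<? o
      ... | yes r<o = begin
        eval (rotateBack f) (+ r)
          ≡⟨ cong (λ b → if b then ⟦ X ⊟ f ⊞ nF ⟧ (+ r) else ⟦ X ⊟ f ⟧ (+ r))
               (dec-true (+ r ℤ.<? ⟦ f ⟧ (+ r)) (subst (+ r <_) (sym (⟦f⟧ (+ r))) (+<+ r<o))) ⟩
        ⟦ X ⊟ f ⊞ nF ⟧ (+ r)                  ≡⟨ ⟦⊞⟧ (X ⊟ f) nF (+ r) ⟩
        ⟦ X ⊟ f ⟧ (+ r) + ⟦ nF ⟧ (+ r)        ≡⟨ cong₂ _+_ (difference r) (⟦⊹⟧ 11 4 (+ r)) ⟩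
        + r - + o + + n                       ≡⟨ regroup (+ r) (+ o) (+ n) ⟩
        + r + (+ n - + o)                     ≡⟨ cong (λ z → + r + z) (∸≡- (ℕ.<⇒≤ o<n)) ⟨
        + (r ℕ.+ (n ℕ.∸ o))                   ≡⟨ cong +_ (ℕ.m<n⇒m%n≡m r+n∸o<n) ⟨
        + ((r ℕ.+ (n ℕ.∸ o)) ℕ.% n)           ∎
        where
        open ≡-Reasoning
        difference : ∀ r → ⟦ X ⊟ f ⟧ (+ r) ≡ + r - + o
        difference r = trans (⟦⊟⟧ X f (+ r)) (cong₂ _-_ (⟦X⟧ (+ r)) (⟦f⟧ (+ r)))
        regroup : ∀ r o n → r - o + n ≡ r + (n - o)
        regroup = solve-∀
        ∸≡- : ∀ {a b} → b ℕ.≤ a → + (a ℕ.∸ b) ≡ + a - + b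
        ∸≡- {a} {b} b≤a = trans (sym (ℤ.⊖-≥ b≤a)) (sym (ℤ.m-n≡m⊖n a b))
        r+n∸o<n : r ℕ.+ (n ℕ.∸ o) ℕ.< n
        r+n∸o<n = subst (r ℕ.+ (n ℕ.∸ o) ℕ.<_) (ℕ.m+[n∸m]≡n (ℕ.<⇒≤ o<n)) (ℕ.+-monoˡ-< (n ℕ.∸ o) r<o)
      ... | no  r≮o = begin
        eval (rotateBack f) (+ r)
          ≡⟨ cong (λ b → if b then ⟦ X ⊟ f ⊞ nF ⟧ (+ r) else ⟦ X ⊟ f ⟧ (+ r))
               (dec-false (+ r ℤ.<? ⟦ f ⟧ (+ r)) (ℤ.≤⇒≯ (subst (_≤ + r) (sym (⟦f⟧ (+ r))) (+≤+ o≤r)))) ⟩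
        ⟦ X ⊟ f ⟧ (+ r)                       ≡⟨ trans (⟦⊟⟧ X f (+ r)) (cong₂ _-_ (⟦X⟧ (+ r)) (⟦f⟧ (+ r))) ⟩
        + r - + o                             ≡⟨ trans (ℤ.m-n≡m⊖n r o) (ℤ.⊖-≥ o≤r) ⟩
        + (r ℕ.∸ o)                           ≡⟨ cong +_ (ℕ.m<n⇒m%n≡m (ℕ.≤-<-trans (ℕ.m∸n≤m r o) r<n)) ⟨
        + ((r ℕ.∸ o) ℕ.% n)                   ≡⟨ cong +_ (ℕ.[m+n]%n≡m%n (r ℕ.∸ o) n) ⟨
        + ((r ℕ.∸ o ℕ.+ n) ℕ.% n)             ≡⟨ cong (λ a → + (a ℕ.% n)) regroup ⟩
        + ((r ℕ.+ (n ℕ.∸ o)) ℕ.% n)           ∎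
        where
        open ≡-Reasoning
        o≤r : o ℕ.≤ r
        o≤r = ℕ.≮⇒≥ r≮o
        regroup : r ℕ.∸ o ℕ.+ n ≡ r ℕ.+ (n ℕ.∸ o)
        regroup = trans (sym (ℕ.+-∸-comm n o≤r)) (ℕ.+-∸-assoc r (ℕ.<⇒≤ o<n))

    rowValues : ℕ → Fin 9 → ℤ
    rowValues r k = value k (columnOf r k)

    rowValues≡ : ∀ {r} → r ℕ.< n → lineValues rowLine (+ r) ≡ reverse (tabulate (rowValues r))
    rowValues≡ {r} r<n = trans (lineValues-reverse (tabulate λ k → rotateBack (offsetF k) , entry k) (+ r)) (cong reverse
      (trans (lineValues-tabulate (rotateBack ∘ offsetF) entry (+ r))
        (List.tabulate-cong λ k → cong (eval (entry k)) (eval-rotateBack r k r<n))))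

    row-isLine : ∀ r → IsLine (row array r)
    row-isLine r =
      let xs , ys , zs≡ , row≡ = row-rotation r
      in subst IsLine (sym row≡) (IsLine-rotate xs ys (subst IsLine zs≡
        ( subst (CyclicallySimple (+ v)) (rowValues≡ (toℕ<n r)) (rows-cyclicallySimple p v ⟦vF⟧ (+≤+ z≤n) (+<⟦nF⟧ (toℕ<n r)))
        , trans (List.length-reverse (tabulate (rowValues (toℕ r)))) (List.length-tabulate (rowValues (toℕ r)))
        , reverse⁺ (All.tabulate⁺ {f = rowValues (toℕ r)} λ k → value-bounded k (ℕ.m%n<n (toℕ r ℕ.+ (n ℕ.∸ offset k)) n)))))

    map-toℤ-ι : ∀ {zs} → All (λ z → - + half ≤ z × z ≤ + half) zs → map toℤ (map (ι {v}) zs) ≡ zs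
    map-toℤ-ι []                        = refl
    map-toℤ-ι ((-h≤z , z≤h) ∷ bounded) = cong₂ _∷_ (toℤ-ι {h = half} v≡1+2half -h≤z z≤h) (map-toℤ-ι bounded)

    line-length : ∀ {zs} → IsLine zs → length (map (ι {v}) zs) ≡ 9
    line-length {zs} (_ , length≡9 , _) = trans (List.length-map ι zs) length≡9

    line-sum : ∀ {zs} → IsLine zs → ∑ (map (ι {v}) zs) ≡ 𝟘
    line-sum {zs} (simple , _) = ≈-unique {z = 0ℤ}
      (subst (∑ (map (ι {v}) zs) ≈_) (CyclicallySimple.sum≡0 simple) (∑-≈ zs)) 𝟘-≈

    line-sumℤ : ∀ {zs} → IsLine zs → ∑ℤ (map toℤ (map (ι {v}) zs)) ≡ 0ℤ
    line-sumℤ (simple , _ , bounded) = trans (cong ∑ℤ (map-toℤ-ι bounded)) (CyclicallySimple.sum≡0 simple)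

    line-simple : ∀ {zs} → IsLine zs → Simple (map (ι {v}) zs)
    line-simple {zs} (simple , _) = cyclicallySimple⇒simple zs simple

    isInteger : Heffter.IsInteger n 9 9 A
    isInteger = record
      { rowSumℤ    = λ r → subst (λ xs → ∑ℤ (map toℤ xs) ≡ 0ℤ) (sym (row-map ι r)) (line-sumℤ (row-isLine r))
      ; columnSumℤ = λ c → subst (λ xs → ∑ℤ (map toℤ xs) ≡ 0ℤ) (sym (column-map ι c)) (line-sumℤ (column-isLine c))
      }

    isGloballySimple : Heffter.IsGloballySimple n 9 9 A
    isGloballySimple = record
      { rowSimple    = λ r → subst Simple (sym (row-map ι r)) (line-simple (row-isLine r))
      ; columnSimple = λ c → subst Simple (sym (column-map ι c)) (line-simple (column-isLine c))
      }

    appears⁺ : ∀ k {c} → c ℕ.< n → Appears A (ι (value k c))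
    appears⁺ k {c} c<n = fromℕ< (ℕ.m%n<n (offset k ℕ.+ c) n) , fromℕ< c<n ,
      subst (λ c′ → A (fromℕ< (ℕ.m%n<n (offset k ℕ.+ c) n)) (fromℕ< c<n) ≡ just (ι (value k c′))) (toℕ-fromℕ< c<n)
        (cell⁺ ι k (trans (toℕ-fromℕ< _) (cong (λ c → (offset k ℕ.+ c) ℕ.% n) (sym (toℕ-fromℕ< c<n)))))

    appears⁻ : ∀ {x} → Appears A x → ∃ λ z → x ≈ z × Admissible signF (+ half) z
    appears⁻ (r , c , eq) with k , _ , refl ← cell⁻ ι {r} {c} eq =
      value k (toℕ c) , ι-≈ (value k (toℕ c)) , admissible-value k (toℕ<n c)

    -- Entries z for x and w for -x are both within ±half, so congruence gives w = -z, which the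
    -- sign table forbids.
    appears-exclusive : ∀ {x} → Appears A x → ¬ Appears A (⊖ x)
    appears-exclusive {x} ax a-x with z , x≈z , admZ ← appears⁻ ax | w , -x≈w , admW ← appears⁻ a-x =
      ownSign-neg signF (Admissible.ownSign admZ) (subst (OwnSign signF) (sym -z≡w) (Admissible.ownSign admW))
      where
      -z≡w : - z ≡ w
      -z≡w = ≈-bounded {h = half} v≡1+2half {⊖ x} (⊖-≈ {x = x} {z} x≈z) -x≈w
        (ℤ.neg-mono-≤ (Admissible.≤half admZ))
        (subst (- z ≤_) (ℤ.neg-involutive (+ half)) (ℤ.neg-mono-≤ (Admissible.-half≤ admZ)))
        (Admissible.-half≤ admW) (Admissible.≤half admW)

    N∣v : N ℕ.∣ v
    N∣v = subst (N ℕ.∣_) (sym v≡9N) (ℕ.n∣m*n 9)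

    ⟦NF⟧∣⇒∣toℕ : ∀ {x : Fin v} {z} → x ≈ z → ⟦ NF ⟧ 0ℤ ∣ z → N ℕ.∣ toℕ x
    ⟦NF⟧∣⇒∣toℕ {x} {z} x≈z N∣z = ℤ.∣⇒∣ᵤ (subst (+ N ∣_) (cancel (+ toℕ x) z)
      (ℤ.∣m∣n⇒∣m+n (ℤ.∣-trans (ℤ.∣ᵤ⇒∣ N∣v) x≈z) (subst (_∣ z) (⟦⊹⟧ 23 8 0ℤ) N∣z)))
      where
      cancel : ∀ x z → x - z + z ≡ x
      cancel = solve-∀

    cell-appears : ∀ {z} → Cell entry nF z → Appears A (ι z) ⊎ Appears A (ι (- z))
    cell-appears {z} record { index = k ; position = c ; 0≤ = 0≤c ; <n = c<n ; value = value≡ } =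
      Sum.map appears appears value≡
      where
      c≡ : + ∣ c ∣ ≡ c
      c≡ = ℤ.0≤i⇒+∣i∣≡i 0≤c
      ∣c∣<n : ∣ c ∣ ℕ.< n
      ∣c∣<n = ℤ.drop‿+<+ (subst₂ _<_ (sym c≡) (⟦⊹⟧ 11 4 0ℤ) c<n)
      appears : ∀ {w} → eval (entry k) c ≡ w → Appears A (ι w)
      appears refl = subst (λ c → Appears A (ι (eval (entry k) c))) c≡ (appears⁺ k ∣c∣<n)

    positive-appears : ∀ {z} → 1ℤ ≤ z → z ≤ + half → ¬ ⟦ NF ⟧ 0ℤ ∣ z → Appears A (ι z) ⊎ Appears A (ι (- z))
    positive-appears {z} 1≤z z≤half N∤z = Sum.[ (λ N∣z → contradiction N∣z N∤z) , cell-appears ]′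
      (values-represented p {z} 1≤z (subst (z <_) (sym (⟦⊹⟧ 104 36 0ℤ)) (ℤ.≤-<-trans z≤half (+<+ ℕ.≤-refl))))

    appears-or-neg : ∀ x → ¬ N ℕ.∣ toℕ x → Appears A x ⊎ Appears A (⊖ x)
    appears-or-neg x N∤x = go (toℤ-bounds {h = half} v≡1+2half x) (ℤ.<-cmp (toℤ x) 0ℤ)
      where
      z : ℤ
      z = toℤ x

      N∤z : ¬ ⟦ NF ⟧ 0ℤ ∣ z
      N∤z N∣z = N∤x (⟦NF⟧∣⇒∣toℕ {x} (toℤ-≈ x) N∣z)

      ιz≡x : ι z ≡ x
      ιz≡x = ≈-unique {z = z} (ι-≈ z) (toℤ-≈ x)

      ι-z≡⊖x : ι (- z) ≡ ⊖ x
      ι-z≡⊖x = ≈-unique {z = - z} (ι-≈ (- z)) (⊖-≈ {x = x} {z} (toℤ-≈ x))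

      go : - + half ≤ z × z ≤ + half → Tri (z < 0ℤ) (z ≡ 0ℤ) (0ℤ < z) → Appears A x ⊎ Appears A (⊖ x)
      go (_ , z≤half) (tri> _ _ 0<z) = Sum.map (subst (Appears A) ιz≡x) (subst (Appears A) ι-z≡⊖x)
        (positive-appears (ℤ.i<j⇒suc[i]≤j 0<z) z≤half N∤z)
      go _ (tri≈ _ z≡0 _) = contradiction (subst (⟦ NF ⟧ 0ℤ ∣_) (sym z≡0) (divides 0ℤ refl)) N∤z
      go (-half≤z , _) (tri< z<0 _ _) = Sum.swap (Sum.map (subst (Appears A) ι-z≡⊖x)
        (subst (Appears A) (trans (cong ι (ℤ.neg-involutive z)) ιz≡x))
        (positive-appears (ℤ.i<j⇒suc[i]≤j (ℤ.neg-mono-< z<0))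
          (subst (- z ≤_) (ℤ.neg-involutive (+ half)) (ℤ.neg-mono-≤ -half≤z))
          λ N∣-z → N∤z (subst (⟦ NF ⟧ 0ℤ ∣_) (ℤ.neg-involutive z) (ℤ.∣m⇒∣-m N∣-z))))

    isHeffter : Heffter.IsHeffter n 9 9 A
    isHeffter = record
      { 3≤k         = ℕ.s≤s (ℕ.s≤s (ℕ.s≤s z≤n))
      ; k≤n         = ℕ.m≤m+n 9 (2 ℕ.+ 4 ℕ.* p)
      ; t∣2nk       = ℕ.n∣m*n (2 ℕ.* n)
      ; rowSize     = λ r → subst (λ xs → length xs ≡ 9) (sym (row-map ι r)) (line-length (row-isLine r))
      ; columnSize  = λ c → subst (λ xs → length xs ≡ 9) (sym (column-map ι c)) (line-length (column-isLine c))
      ; J           = multiples N v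
      ; J-subgroup  = multiples-isSubgroup N v N∣v
      ; J-order     = multiples-order 9 N {v} v≡9N
      ; support     = λ x x∉J → support x (x∉J ∘ ∈multiples⁺ N v)
      ; rowSum      = λ r → subst (λ xs → ∑ xs ≡ 𝟘) (sym (row-map ι r)) (line-sum (row-isLine r))
      ; columnSum   = λ c → subst (λ xs → ∑ xs ≡ 𝟘) (sym (column-map ι c)) (line-sum (column-isLine c))
      }
      where
      support : ∀ x → ¬ N ℕ.∣ toℕ x → (Appears A x × ¬ Appears A (⊖ x)) ⊎ (¬ Appears A x × Appears A (⊖ x))
      support x N∤x = Sum.map (λ a → a , appears-exclusive a) (λ a → (λ a′ → appears-exclusive a′ a) , a) (appears-or-neg x N∤x)

    follow : ∀ k → ∃ λ j → next k ℕ.% n ≡ offset j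
    follow 0F = 1F , ℕ.m<n⇒m%n≡m (offset<n 1F)
    follow 1F = 2F , ℕ.m<n⇒m%n≡m (offset<n 2F)
    follow 2F = 3F , ℕ.m<n⇒m%n≡m (offset<n 3F)
    follow 3F = 4F , ℕ.m<n⇒m%n≡m (offset<n 4F)
    follow 4F = 5F , ℕ.m<n⇒m%n≡m (offset<n 5F)
    follow 5F = 6F , ℕ.m<n⇒m%n≡m (offset<n 6F)
    follow 6F = 7F , ℕ.m<n⇒m%n≡m (offset<n 7F)
    follow 7F = 8F , ℕ.m<n⇒m%n≡m (offset<n 8F)
    -- Here `next` is n, so the cyclic order returns to diagonal 0.
    follow 8F = 0F , ℕ.n%n≡0 n

    offset<next : ∀ k → offset k ℕ.< next k
    offset<next k = at-p-mono-< (from-yes (Fin.all? λ k → boundCoeffs (inject₁ k) ≺? boundCoeffs (suc k)) k)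

    next≤n : ∀ k → next k ℕ.≤ n
    next≤n k = at-p-mono-≤ (from-yes (Fin.all? λ k → boundCoeffs (suc k) ≼? (11 , 4)) k)

    module _ {r w} (strip : IsEmptyStrip A r w) {k} (r≡ : toℕ r ≡ offset k) where
      open IsEmptyStrip strip

      toℕ-⊕ℕ : ∀ i → toℕ (r ⊕ℕ i) ≡ (offset k ℕ.+ i) ℕ.% n
      toℕ-⊕ℕ i = trans (toℕ-fromℕ< _) (cong (λ o → (o ℕ.+ i) ℕ.% n) r≡)

      -- If the strip ended earlier, the filled diagonal that closes it would lie strictly between
      -- two consecutive offsets. If it ended later, the filled diagonal at `next k` would be among
      -- its empty ones.
      strip-end : offset k ℕ.+ suc w ≡ next k
      strip-end with ℕ.<-cmp (offset k ℕ.+ suc w) (next k)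
      ... | tri≈ _ ≡next _ = ≡next
      ... | tri< <next _ _ with j , ≡offset ← filledDiagonal⁻ ι filledAfter =
        contradiction (trans (sym (ℕ.m<n⇒m%n≡m (ℕ.<-≤-trans <next (next≤n k)))) (trans (sym (toℕ-⊕ℕ (suc w))) ≡offset))
          (not-offset (no-offset-between k j))
        where
        not-offset : offset j ℕ.≤ offset k ⊎ next k ℕ.≤ offset j → offset k ℕ.+ suc w ≢ offset j
        not-offset (inj₁ ≤k)    eq = ℕ.m+1+n≰m (offset k) (ℕ.≤-trans (ℕ.≤-reflexive eq) ≤k)
        not-offset (inj₂ next≤) eq = ℕ.<⇒≱ <next (ℕ.≤-trans next≤ (ℕ.≤-reflexive (sym eq)))
      ... | tri> _ _ next< with j , next%n≡ ← follow k =
        contradiction (trans (toℕ-⊕ℕ gap) (trans (cong (ℕ._% n) offset+gap) next%n≡))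
          (emptyDiagonal⁻ ι (empty gap (ℕ.m<n⇒0<n∸m (offset<next k)) gap≤w) j)
        where
        gap : ℕ
        gap = next k ℕ.∸ offset k
        offset+gap : offset k ℕ.+ gap ≡ next k
        offset+gap = ℕ.m+[n∸m]≡n (ℕ.<⇒≤ (offset<next k))
        gap≤w : gap ℕ.≤ w
        gap≤w = ℕ.s≤s⁻¹ (ℕ.+-cancelˡ-< (offset k) gap (suc w) (subst (ℕ._< offset k ℕ.+ suc w) (sym offset+gap) next<))

    long-gap : (n ℕ.∸ 9) ℕ./ 2 ≡ 1 ℕ.+ 2 ℕ.* p
    long-gap = trans (cong (ℕ._/ 2) (lemma p)) (ℕ.m*n/n≡m (1 ℕ.+ 2 ℕ.* p) 2)
      where
      lemma : ∀ p → 2 ℕ.+ 4 ℕ.* p ≡ (1 ℕ.+ 2 ℕ.* p) ℕ.* 2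
      lemma = ℕ.solve-∀

    width≡ : ∀ k {w} → 1 ℕ.≤ w → offset k ℕ.+ suc w ≡ next k → w ≡ (n ℕ.∸ 9) ℕ./ 2
    width≡ k {w} 1≤w eq = case k eq
      where
      -- Each offset is followed either by its successor or by a strip of width 1 + 2p.
      wide : ∀ {o} → o ℕ.+ suc w ≡ o ℕ.+ suc (1 ℕ.+ 2 ℕ.* p) → w ≡ (n ℕ.∸ 9) ℕ./ 2
      wide {o} eq = trans (ℕ.suc-injective (ℕ.+-cancelˡ-≡ o (suc w) (suc (1 ℕ.+ 2 ℕ.* p)) eq)) (sym long-gap)
      tight : ∀ {o} → o ℕ.+ suc w ≡ suc o → w ≡ (n ℕ.∸ 9) ℕ./ 2
      tight {o} eq = contradiction
        (ℕ.suc-injective (ℕ.+-cancelˡ-≡ o (suc w) 1 (trans eq (ℕ.+-comm 1 o)))) (ℕ.>⇒≢ 1≤w)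
      case : ∀ k → offset k ℕ.+ suc w ≡ next k → w ≡ (n ℕ.∸ 9) ℕ./ 2
      case 0F eq = tight {offset 0F} eq
      case 1F eq = tight {offset 1F} eq
      case 2F eq = tight {offset 2F} eq
      case 3F eq = tight {offset 3F} eq
      case 4F eq = wide {offset 4F} (trans eq (lemma p))
        where
        lemma : ∀ p → 6 ℕ.+ 2 ℕ.* p ≡ 4 ℕ.+ 0 ℕ.* p ℕ.+ suc (1 ℕ.+ 2 ℕ.* p)
        lemma = ℕ.solve-∀
      case 5F eq = tight {offset 5F} eq
      case 6F eq = tight {offset 6F} eq
      case 7F eq = tight {offset 7F} eq
      case 8F eq = wide {offset 8F} (trans eq (lemma p))
        where
        lemma : ∀ p → 11 ℕ.+ 4 ℕ.* p ≡ 9 ℕ.+ 2 ℕ.* p ℕ.+ suc (1 ℕ.+ 2 ℕ.* p)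
        lemma = ℕ.solve-∀

    hasWidth : IsDiagonalWithWidth A 9 ((n ℕ.∸ 9) ℕ./ 2)
    hasWidth = record
      { k<n      = ℕ.m≤m+n 10 (1 ℕ.+ 4 ℕ.* p)
      ; diagonal = isDiagonal ι
      ; width    = λ r w strip → let k , r≡ = filledDiagonal⁻ ι (IsEmptyStrip.filledBefore strip)
                                 in width≡ k (IsEmptyStrip.nonempty strip) (strip-end strip {k} r≡)
      }

  11+4* : ∀ {n} → n ≥ 11 → n ℕ.% 4 ≡ 3 → n ≡ 11 ℕ.+ 4 ℕ.* ((n ℕ.∸ 11) ℕ./ 4)
  11+4* {n} n≥11 n%4≡3 = trans (sym (ℕ.m+[n∸m]≡n n≥11)) (cong (11 ℕ.+_)
    (trans (sym (ℕ.m/n*n≡m 4∣n∸11)) (ℕ.*-comm ((n ℕ.∸ 11) ℕ./ 4) 4)))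
    where
    4∣n∸11 : 4 ℕ.∣ n ℕ.∸ 11
    -- n ∸ 11 is suc n ∸ 12 by definition. As 12 is a multiple of 4, the remainder is that of suc n,
    -- which is 0.
    4∣n∸11 = ℕ.m%n≡0⇒n∣m (n ℕ.∸ 11) 4 (trans (ℕ.m*n≤o⇒[o∸m*n]%n≡o%n 3 {4} {suc n} (ℕ.s≤s n≥11))
      (trans (ℕ.%-distribˡ-+ 1 n 4) (cong (λ r → (1 ℕ.+ r) ℕ.% 4) n%4≡3)))

open HeffterArray using (module Construction; 11+4*)

proposition4p8 : ∀ (n : ℕ) → n ≥ 11 → n % 4 ≡ 3 →
    ∃ λ (A : Heffter.Array n 9 9) →
    Heffter.IsHeffter n 9 9 A ×
    Heffter.IsInteger n 9 9 A ×
    Heffter.IsGloballySimple n 9 9 A ×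
    IsDiagonalWithWidth A 9 ((n ∸ 9) / 2)
proposition4p8 n n≥11 n%4≡3 = subst Solvable (sym (11+4* n≥11 n%4≡3))
  (A , isHeffter , isInteger , isGloballySimple , hasWidth)
  where
  open import Data.Product.Base using (_,_)
  open import Relation.Binary.PropositionalEquality using (subst; sym)
  open Construction ((n ∸ 11) / 4) using (A; isHeffter; isInteger; isGloballySimple; hasWidth)
  Solvable : ℕ → Set
  Solvable n = ∃ λ (A : Heffter.Array n 9 9) →
    Heffter.IsHeffter n 9 9 A × Heffter.IsInteger n 9 9 A × Heffter.IsGloballySimple n 9 9 A ×
    IsDiagonalWithWidth A 9 ((n ∸ 9) / 2)
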